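{- Let $d\geq 1$ and let $c$ be the squarefree part of $d$ (the product of the distinct primes dividing $d$). Then every cyclotomic factor of $M_d(x)$ is induced from a cyclotomic factor of $M_c(x)$: that is, if $\Phi_m(x)$ divides $M_d(x)$, then there is $n\geq 1$ such that $\Phi_n(x)$ divides $M_c(x)$ and $\Phi_m(x)$ divides $\Phi_n(x^{d/c})$.
   Context: $M_d(x)=\frac1d\sum_{e\mid d}\mu(e)x^{d/e}\in\mathbb{Q}[x]$ is the $d$th necklace polynomial ($\mu$ the Möbius function), and $\Phi_m(x)$ is the $m$th cyclotomic polynomial. -}

module Defs where

open import Data.Nat as ℕ using (ℕ; zero; suc; _≤_)
open import Data.Nat.DivMod using (_/_)
open import Data.Nat.Divisibility using (_∣_; _∣?_)
open import Data.Nat.Primality using (Prime; prime?)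
open import Data.Integer as ℤ using (ℤ; +_)
open import Data.Rational as ℚ using (ℚ; 0ℚ; 1ℚ)
open import Data.List using (List; []; _∷_; _++_; map; filter; upTo; length; replicate; foldr)
open import Data.Bool.ListAction using (any)
open import Data.Bool using (Bool; true; false; if_then_else_)
open import Data.Product using (Σ; _×_)
open import Relation.Nullary.Decidable using (_×-dec_; ⌊_⌋)
open import Relation.Binary.PropositionalEquality using (_≡_)

primeDivisors : ℕ → List ℕ
primeDivisors n = filter (λ p → prime? p ×-dec p ∣? n) (upTo (suc n))

rad : ℕ → ℕ
rad d = foldr ℕ._*_ 1 (primeDivisors d)

μ : ℕ → ℤ
μ n = if any (λ p → ⌊ (p ℕ.* p) ∣? n ⌋) (primeDivisors n)
        then + 0
        else ((ℤ.- + 1) ℤ.^ length (primeDivisors n))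

-- natural-number quotient, with the convention a ÷ 0 = 0 (only used with nonzero divisor)
divN : ℕ → ℕ → ℕ
divN a zero = 0
divN a (suc b) = a / suc b

divisors : ℕ → List ℕ
divisors n = filter (_∣? n) (map suc (upTo n))

-- Polynomials over ℚ, as coefficient lists (lowest degree first)

Poly : Set
Poly = List ℚ

coeff : Poly → ℕ → ℚ
coeff [] i = 0ℚ
coeff (a ∷ p) zero = a
coeff (a ∷ p) (suc i) = coeff p i

-- equality of polynomials: all coefficients agree (trailing zeros irrelevant)
_≈ₚ_ : Poly → Poly → Set
p ≈ₚ q = ∀ i → coeff p i ≡ coeff q i

infixl 6 _+ₚ_
infixl 7 _*ₚ_

_+ₚ_ : Poly → Poly → Poly
[] +ₚ q = q
(a ∷ p) +ₚ [] = a ∷ p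
(a ∷ p) +ₚ (b ∷ q) = (a ℚ.+ b) ∷ (p +ₚ q)

scaleₚ : ℚ → Poly → Poly
scaleₚ c p = map (c ℚ.*_) p

_*ₚ_ : Poly → Poly → Poly
[] *ₚ q = []
(a ∷ p) *ₚ q = scaleₚ a q +ₚ (0ℚ ∷ (p *ₚ q))

monomial : ℕ → ℚ → Poly
monomial k c = replicate k 0ℚ ++ (c ∷ [])

xPowMinusOne : ℕ → Poly
xPowMinusOne k = monomial k 1ℚ +ₚ ((ℚ.- 1ℚ) ∷ [])

prodₚ : List Poly → Poly
prodₚ = foldr _*ₚ_ (1ℚ ∷ [])

expand : ℕ → Poly → Poly
expand k [] = []
expand k (a ∷ p) = (a ∷ []) +ₚ (monomial k 1ℚ *ₚ expand k p)

_∣ₚ_ : Poly → Poly → Set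
p ∣ₚ q = Σ Poly (λ r → q ≈ₚ (p *ₚ r))

-- 1/d as a rational, with the convention 1/0 = 0 (only used for d ≥ 1)
invN : ℕ → ℚ
invN zero = 0ℚ
invN (suc k) = (+ 1) ℚ./ suc k

necklace : ℕ → Poly
necklace d = scaleₚ (invN d)
  (foldr _+ₚ_ [] (map (λ e → monomial (divN d e) (μ e ℚ./ 1)) (divisors d)))

-- Cyclotomic polynomial via the Möbius product formula
--   Φ_m(x) = ∏_{e ∣ m} (x^e - 1)^{μ(m/e)},
-- cleared of denominators: Φ_m · ∏_{μ(m/e) = -1} (x^e - 1) = ∏_{μ(m/e) = 1} (x^e - 1).
-- Since ℚ[x] is an integral domain this determines Φ_m uniquely.
IsCyclotomic : ℕ → Poly → Set
IsCyclotomic m P =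
  1 ≤ m ×
  (P *ₚ prodₚ (map xPowMinusOne (filter (λ e → μ (divN m e) ℤ.≟ ℤ.-[1+ 0 ]) (divisors m))))
    ≈ₚ prodₚ (map xPowMinusOne (filter (λ e → μ (divN m e) ℤ.≟ + 1) (divisors m)))

{-# OPTIONS --safe #-}
module Submission where

-- With c = rad d and k = d / c, only squarefree divisors contribute to M_d, so M_d(x) is a
-- constant multiple of M_c(xᵏ).  For a prime p dividing k, f(xᵖ) vanishes at the primitive m-th
-- roots of unity iff f vanishes at their p-th powers, the primitive m/gcd(m,p)-th roots of unity;
-- iterating over the primes of k gives n.  Roots of unity are avoided as follows.
-- If p ∤ m, then x ↦ xᵘ with up ≡ 1 mod m inverts x ↦ xᵖ modulo Φₘ ∣ xᵐ − 1.
-- If m = pn, then Φₘ(x) = Φₙ(xᵖ) or Φₘ(x)Φₙ(x) = Φₙ(xᵖ), and comparing the coefficients at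
-- multiples of p in f(xᵖ) = Φₘ(x) r(x), multiplied by xⁿ − 1 in the second case, gives Φₙ ∣ f.
-- The Φₙ are built one prime at a time; Φₙ(x) ∣ Φₙ(xᵘ) for u coprime to n holds because the
-- quotients Φₙ(xᵘ)/Φₙ(x) and Φₙ(xᵛ)/Φₙ(x) are comaximal for coprime u and v.

open import Defs
open import Algebra.Bundles using (CommutativeMonoid; CommutativeRing)
open import Data.Bool using (Bool; true; false; T; if_then_else_)
open import Data.Bool.ListAction using (any)
open import Data.Empty using (⊥-elim)
open import Data.Integer as ℤ using (ℤ; +_)
import Data.Integer.Properties as ℤ
open import Data.List using (List; []; _∷_; _++_; applyUpTo; filter; foldr; length; map; replicate; upTo)
open import Data.List.Membership.Propositional using (_∈_; find; lose)
open import Data.List.Membership.Propositional.Properties using (∈-filter⁺; ∈-filter⁻; ∈-upTo⁺; ∈-map⁺; ∈-map⁻; ∈-++⁺ˡ; ∈-++⁺ʳ; ∈-++⁻)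
open import Data.List.Membership.Propositional.Properties.WithK using (unique∧set⇒bag)
open import Data.List.Relation.Binary.BagAndSetEquality using (∼bag⇒↭)
open import Data.List.Relation.Binary.Permutation.Propositional as ↭ using (_↭_)
open import Data.List.Relation.Binary.Permutation.Propositional.Properties using (↭-length)
open import Data.List.Relation.Unary.All as All using (All; []; _∷_)
open import Data.List.Relation.Unary.Any using (here; there)
open import Data.List.Relation.Unary.Any.Properties using (any⁺; any⁻)
open import Data.List.Relation.Unary.Unique.Propositional using (Unique; []; _∷_)
import Data.List.Relation.Unary.Unique.Propositional.Properties as Unique
open import Data.Nat as ℕ using (ℕ; zero; suc; NonZero; _≤_; z≤n; s≤s)
open import Data.Nat.Coprimality as Coprime using (Coprime)
import Data.Nat.Divisibility as ℕ
import Data.Nat.DivMod as ℕ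
open import Data.Nat.GCD using (module Bézout)
open import Data.Nat.ListAction using (product)
open import Data.Nat.Primality using (Prime; prime?; euclidsLemma; prime⇒nonZero; prime⇒irreducible; productOfPrimes≢0; ¬prime[1])
open import Data.Nat.Primality.Factorisation using (factorise; module PrimeFactorisation; factorisationHasAllPrimeFactors)
import Data.Nat.Properties as ℕ
open import Data.Nat.Solver using (module +-*-Solver)
open import Data.Product using (Σ; ∃; ∃₂; _×_; _,_; proj₁; proj₂)
open import Data.Rational as ℚ using (ℚ; 0ℚ; 1ℚ)
import Data.Rational.Properties as ℚ
open import Data.Sum using (inj₁; inj₂; [_,_]′)
open import Function using (_∘_; case_of_; mk⇔)
open import Level using (0ℓ)
open import Relation.Binary.Bundles using (Setoid)
open import Relation.Binary.PropositionalEquality as ≡ using (_≡_; _≢_; cong; cong₂; module ≡-Reasoning)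
import Relation.Binary.Reasoning.Setoid as SetoidReasoning
open import Relation.Binary.Structures using (IsEquivalence)
open import Relation.Nullary using (¬_; Dec; yes; no; contradiction)
open import Relation.Nullary.Decidable using (_×-dec_; ⌊_⌋; toWitness; fromWitness; ¬?; decidable-stable)
open import Relation.Unary using (Decidable)
open import Algebra.Properties.CommutativeSemigroup ℕ.*-commutativeSemigroup using (x∙yz≈y∙xz; x∙yz≈xy∙z)
open import Algebra.Properties.CommutativeSemigroup (CommutativeRing.+-commutativeSemigroup ℚ.+-*-commutativeRing) using () renaming (interchange to ℚ-+-interchange)

-- Primes

-- The argument uses neither degrees, nor division with remainder, nor irreducibility of Φₙ.
-- Cancellation works from the constant term: every factor cancelled is nonzero at 0. Common-factor
-- arguments are explicit Bézout identities, which all originate in Bézout for the lengths of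
-- geometric sums. Comaximality has to be carried through the construction of Φₙ. For u ≥ 1 coprime
-- to n, Φₙ(xᵘ) is the product of the Φ with index n·d over d ∣ u, so the quotients by Φₙ(x) for
-- coprime u and v share no factor. When p ∤ n, the new polynomial Φₚₙ is itself such a quotient,
-- the one for u = p. Divisibility of Φₚₙ(xᵘ) by Φₚₙ(x) then follows by Euclid's lemma, from the
-- comaximality of Φₚₙ(x) and Φₙ(xᵘ)/Φₙ(x); divisibility alone would not be a strong enough
-- induction hypothesis. In the descent for m = pn with p ∤ n, the factor xⁿ - 1 supplies the Φₙ(x)
-- that completes Φₘ(x) to a polynomial in xᵖ, while among the coefficients at multiples of p it
-- acts only as the constant -1.

prime-induction : (P : ℕ → Set) → P 1 → (∀ p n → Prime p → .{{NonZero n}} → P n → P (p ℕ.* n)) →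
  ∀ n → .{{NonZero n}} → P n
prime-induction P P1 step n = ≡.subst P (≡.sym isFactorisation) (go factors factorsPrime)
  where
  open PrimeFactorisation (factorise n)
  go : ∀ ps → All Prime ps → P (product ps)
  go []       []         = P1
  go (p ∷ ps) (pr ∷ prs) = step p (product ps) pr {{productOfPrimes≢0 prs}} (go ps prs)

prime∤⇒coprime : ∀ {p n} → Prime p → ¬ p ℕ.∣ n → Coprime p n
prime∤⇒coprime pr p∤n (i∣p , i∣n) with prime⇒irreducible pr i∣p
... | inj₁ i≡1    = i≡1
... | inj₂ ≡.refl = contradiction i∣n p∤n

prime∣prime⇒≡ : ∀ {p q} → Prime p → Prime q → p ℕ.∣ q → p ≡ q
prime∣prime⇒≡ p-pr q-pr p∣q with prime⇒irreducible q-pr p∣q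
... | inj₁ ≡.refl = contradiction p-pr ¬prime[1]
... | inj₂ p≡q    = p≡q

coprime-*-∣ : ∀ {m n d} → Coprime m n → m ℕ.∣ d → n ℕ.∣ d → m ℕ.* n ℕ.∣ d
coprime-*-∣ {m} {n} c m∣d (ℕ.divides q ≡.refl) =
  ℕ.*-monoˡ-∣ n (Coprime.coprime-divisor c (≡.subst (m ℕ.∣_) (ℕ.*-comm q n) m∣d))

inverse-mod : ∀ p m → .{{NonZero p}} → .{{NonZero m}} → Coprime p m → ∃₂ λ u v → u ℕ.* p ≡ 1 ℕ.+ m ℕ.* v
inverse-mod p m p⊥m with Coprime.coprime-Bézout p⊥m
inverse-mod p m _ | Bézout.+- x y eq = x , y , ≡.trans (≡.sym eq) (cong suc (ℕ.*-comm y m))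
-- Here 1 + x·P = y·M with P = `suc p` and M = `suc m`, so -x inverts P modulo M. The natural number
-- x·m is congruent to -x, and adding one more M keeps the cofactor m·y + p free of subtraction.
inverse-mod (suc p) (suc m) _ | Bézout.-+ x y eq = x ℕ.* m ℕ.+ suc m , m ℕ.* y ℕ.+ p , (begin
  (x ℕ.* m ℕ.+ suc m) ℕ.* suc p
    ≡⟨ solve 3 (λ x m p → (x :* m :+ (con 1 :+ m)) :* (con 1 :+ p) := con 1 :+ (m :* (con 1 :+ x :* (con 1 :+ p)) :+ (con 1 :+ m) :* p)) ≡.refl x m p ⟩
  1 ℕ.+ (m ℕ.* (1 ℕ.+ x ℕ.* suc p) ℕ.+ suc m ℕ.* p)
    ≡⟨ cong (λ t → 1 ℕ.+ (m ℕ.* t ℕ.+ suc m ℕ.* p)) eq ⟩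
  1 ℕ.+ (m ℕ.* (y ℕ.* suc m) ℕ.+ suc m ℕ.* p)
    ≡⟨ solve 3 (λ y m p → con 1 :+ (m :* (y :* (con 1 :+ m)) :+ (con 1 :+ m) :* p) := con 1 :+ (con 1 :+ m) :* (m :* y :+ p)) ≡.refl y m p ⟩
  1 ℕ.+ suc m ℕ.* (m ℕ.* y ℕ.+ p) ∎)
  where
  open ≡-Reasoning
  open +-*-Solver

inverse-coprime : ∀ {p m u v} → u ℕ.* p ≡ 1 ℕ.+ m ℕ.* v → Coprime u m
inverse-coprime {p} {m} {u} {v} eq {i} (i∣u , i∣m) = ℕ.∣1⇒≡1
  (ℕ.∣m+n∣m⇒∣n (≡.subst (i ℕ.∣_) (≡.trans eq (ℕ.+-comm 1 (m ℕ.* v))) (ℕ.∣m⇒∣m*n p i∣u)) (ℕ.∣m⇒∣m*n v i∣m))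

-- Finite sets as duplicate-free lists

-- Products and sums over divisor lists do not see the order, so such lists need only be compared as
-- sets; each comparison becomes two membership proofs.
unique-⇔⇒↭ : {A : Set} {xs ys : List A} → Unique xs → Unique ys →
  (∀ {x} → x ∈ xs → x ∈ ys) → (∀ {x} → x ∈ ys → x ∈ xs) → xs ↭ ys
unique-⇔⇒↭ xs! ys! xs⊆ys ys⊆xs = ∼bag⇒↭ (unique∧set⇒bag xs! ys! (mk⇔ xs⊆ys ys⊆xs))

∈-primeDivisors⁺ : ∀ {p n} → .{{NonZero n}} → Prime p → p ℕ.∣ n → p ∈ primeDivisors n
∈-primeDivisors⁺ {n = n} pr p∣n =
  ∈-filter⁺ (λ p → prime? p ×-dec p ℕ.∣? n) (∈-upTo⁺ (s≤s (ℕ.∣⇒≤ p∣n))) (pr , p∣n)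

∈-primeDivisors⁻ : ∀ {p n} → p ∈ primeDivisors n → Prime p × p ℕ.∣ n
∈-primeDivisors⁻ {n = n} p∈ = proj₂ (∈-filter⁻ (λ p → prime? p ×-dec p ℕ.∣? n) {xs = upTo (suc n)} p∈)

primeDivisors-unique : ∀ n → Unique (primeDivisors n)
primeDivisors-unique n = Unique.filter⁺ (λ p → prime? p ×-dec p ℕ.∣? n) (Unique.upTo⁺ (suc n))

∈-divisors⁺ : ∀ {e n} → .{{NonZero n}} → e ℕ.∣ n → e ∈ divisors n
∈-divisors⁺ {zero}  {n} e∣n = contradiction (ℕ.0∣⇒≡0 e∣n) (ℕ.≢-nonZero⁻¹ n)
∈-divisors⁺ {suc e} {n} e∣n = ∈-filter⁺ (ℕ._∣? n) (∈-map⁺ suc (∈-upTo⁺ (ℕ.∣⇒≤ e∣n))) e∣n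

∈-divisors⁻ : ∀ {e n} → e ∈ divisors n → NonZero e × e ℕ.∣ n
∈-divisors⁻ {n = n} e∈ with ∈-filter⁻ (ℕ._∣? n) {xs = map suc (upTo n)} e∈
... | e∈map , e∣n with ∈-map⁻ suc e∈map
...   | _ , _ , ≡.refl = _ , e∣n

divisors-unique : ∀ n → Unique (divisors n)
divisors-unique n = Unique.filter⁺ (ℕ._∣? n) (Unique.map⁺ ℕ.suc-injective (Unique.upTo⁺ n))

divN-* : ∀ q e → .{{NonZero e}} → divN (q ℕ.* e) e ≡ q
divN-* q (suc e) = ℕ.m*n/n≡m q (suc e)

-- The Möbius function

-- The test inside `μ`: since `μ` unfolds to a conditional on it, a case split on the test computes
-- `μ`.
hasSquare : ℕ → Bool
hasSquare n = any (λ p → ⌊ (p ℕ.* p) ℕ.∣? n ⌋) (primeDivisors n)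

hasSquare⁺ : ∀ {q n} → .{{NonZero n}} → Prime q → q ℕ.* q ℕ.∣ n → T (hasSquare n)
hasSquare⁺ {q} {n} pr q²∣n = any⁺ _ (lose (∈-primeDivisors⁺ pr (ℕ.∣-trans (ℕ.m∣m*n q) q²∣n)) (fromWitness {a? = (q ℕ.* q) ℕ.∣? n} q²∣n))

hasSquare⁻ : ∀ {n} → T (hasSquare n) → ∃ λ q → Prime q × q ℕ.* q ℕ.∣ n
hasSquare⁻ {n} t with find (any⁻ _ (primeDivisors n) t)
... | q , q∈ , q²∣n = q , proj₁ (∈-primeDivisors⁻ {n = n} q∈) , toWitness q²∣n

T-⇔⇒≡ : ∀ {a b} → (T a → T b) → (T b → T a) → a ≡ b
T-⇔⇒≡ {true}  {true}  f g = ≡.refl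
T-⇔⇒≡ {true}  {false} f g = ⊥-elim (f _)
T-⇔⇒≡ {false} {true}  f g = ⊥-elim (g _)
T-⇔⇒≡ {false} {false} f g = ≡.refl

μ-square : ∀ {p n} → .{{NonZero n}} → Prime p → p ℕ.* p ℕ.∣ n → μ n ≡ + 0
μ-square {p} {n} pr p²∣n with hasSquare n | hasSquare⁺ pr p²∣n
... | true | _ = ≡.refl

module _ {p a : ℕ} (pr : Prime p) .{{_ : NonZero a}} (p∤a : ¬ p ℕ.∣ a) where

  private
    instance
      p-nonZero : NonZero p
      p-nonZero = prime⇒nonZero pr
      pa-nonZero : NonZero (p ℕ.* a)
      pa-nonZero = ℕ.m*n≢0 p a

  -- A prime q with q² ∣ p·a differs from p, because p occurs only once; then q² is coprime to p and
  -- divides a.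
  hasSquare-∤ : hasSquare (p ℕ.* a) ≡ hasSquare a
  hasSquare-∤ = T-⇔⇒≡ to from
    where
    from : T (hasSquare a) → T (hasSquare (p ℕ.* a))
    from t = let q , q-pr , q²∣a = hasSquare⁻ {a} t in hasSquare⁺ q-pr (ℕ.∣n⇒∣m*n p q²∣a)

    to : T (hasSquare (p ℕ.* a)) → T (hasSquare a)
    to t with hasSquare⁻ {p ℕ.* a} t
    ... | q , q-pr , q²∣pa with q ℕ.∣? p
    ...   | yes q∣p with prime∣prime⇒≡ q-pr pr q∣p
    ...     | ≡.refl = contradiction (ℕ.*-cancelˡ-∣ p q²∣pa) p∤a
    to t | q , q-pr , q²∣pa | no q∤p = hasSquare⁺ q-pr (Coprime.coprime-divisor q²-coprime-p q²∣pa)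
      where
      q-coprime-p : Coprime q p
      q-coprime-p = prime∤⇒coprime q-pr q∤p
      q²-coprime-p : Coprime (q ℕ.* q) p
      q²-coprime-p {i} (i∣q² , i∣p) with prime⇒irreducible pr i∣p
      ... | inj₁ i≡1    = i≡1
      ... | inj₂ ≡.refl = [ both , both ]′ (euclidsLemma q q pr i∣q²)
        where
        both : p ℕ.∣ q → p ≡ 1
        both p∣q = q-coprime-p (p∣q , i∣p)

  primeDivisors-∤ : primeDivisors (p ℕ.* a) ↭ p ∷ primeDivisors a
  primeDivisors-∤ = unique-⇔⇒↭ (primeDivisors-unique (p ℕ.* a))
    (All.tabulate (λ { x∈ ≡.refl → p∤a (proj₂ (∈-primeDivisors⁻ {n = a} x∈)) }) ∷ primeDivisors-unique a) to from
    where
    to : ∀ {x} → x ∈ primeDivisors (p ℕ.* a) → x ∈ p ∷ primeDivisors a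
    to x∈ with ∈-primeDivisors⁻ {n = p ℕ.* a} x∈
    ... | x-pr , x∣pa with euclidsLemma p a x-pr x∣pa
    ...   | inj₁ x∣p = here (prime∣prime⇒≡ x-pr pr x∣p)
    ...   | inj₂ x∣a = there (∈-primeDivisors⁺ x-pr x∣a)
    from : ∀ {x} → x ∈ p ∷ primeDivisors a → x ∈ primeDivisors (p ℕ.* a)
    from (here ≡.refl) = ∈-primeDivisors⁺ pr (ℕ.m∣m*n a)
    from (there x∈)    = let x-pr , x∣a = ∈-primeDivisors⁻ {n = a} x∈ in ∈-primeDivisors⁺ x-pr (ℕ.∣n⇒∣m*n p x∣a)

  μ-∤ : μ (p ℕ.* a) ≡ ℤ.- μ a
  μ-∤ = begin
    (if hasSquare (p ℕ.* a) then + 0 else sign (length (primeDivisors (p ℕ.* a))))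
      ≡⟨ cong₂ (λ b l → if b then + 0 else sign l) hasSquare-∤ (↭-length primeDivisors-∤) ⟩
    (if hasSquare a then + 0 else sign (suc (length (primeDivisors a))))
      ≡⟨ negate (hasSquare a) (length (primeDivisors a)) ⟩
    ℤ.- μ a ∎
    where
    open ≡-Reasoning
    sign : ℕ → ℤ
    sign l = (ℤ.- + 1) ℤ.^ l
    negate : ∀ b l → (if b then + 0 else sign (suc l)) ≡ ℤ.- (if b then + 0 else sign l)
    negate true  l = ≡.refl
    negate false l = ℤ.-1*i≡-i (sign l)

-- The exponents in the product formula for Φₙ

-- For s = -1 and s = 1 these are definitionally the two lists in `IsCyclotomic`. Keeping s variable
-- treats both at once, and adjoining a new prime relates the list for s to the one for -s.
exponents : ℤ → ℕ → List ℕ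
exponents s n = filter (λ e → μ (divN n e) ℤ.≟ s) (divisors n)

exponents-unique : ∀ s n → Unique (exponents s n)
exponents-unique s n = Unique.filter⁺ (λ e → μ (divN n e) ℤ.≟ s) (divisors-unique n)

∈-exponents⁺ : ∀ {s e n} q → .{{NonZero n}} → n ≡ q ℕ.* e → μ q ≡ s → e ∈ exponents s n
∈-exponents⁺ {s} {e} {n} q ≡.refl μq≡s = ∈-filter⁺ (λ e → μ (divN n e) ℤ.≟ s)
  (∈-divisors⁺ (ℕ.divides q ≡.refl)) (≡.trans (cong μ (divN-* q e {{ℕ.m*n≢0⇒n≢0 q}})) μq≡s)

∈-exponents⁻ : ∀ {s e n} → e ∈ exponents s n → ∃ λ q → n ≡ q ℕ.* e × μ q ≡ s
∈-exponents⁻ {s} {e} {n} e∈ with ∈-filter⁻ (λ e → μ (divN n e) ℤ.≟ s) {xs = divisors n} e∈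
... | e∈div , μ≡s with ∈-divisors⁻ {n = n} e∈div
...   | e-nonZero , ℕ.divides q ≡.refl = q , ≡.refl , ≡.trans (cong μ (≡.sym (divN-* q e {{e-nonZero}}))) μ≡s

module _ {p n : ℕ} (pr : Prime p) .{{_ : NonZero n}} where

  private
    instance
      p-nonZero : NonZero p
      p-nonZero = prime⇒nonZero pr
      pn-nonZero : NonZero (p ℕ.* n)
      pn-nonZero = ℕ.m*n≢0 p n

    cofactor-nonZero : ∀ {q e} → p ℕ.* n ≡ q ℕ.* e → NonZero q
    cofactor-nonZero {q} {e} eq = ℕ.m*n≢0⇒m≢0 q {n = e} {{≡.subst NonZero eq pn-nonZero}}

    map-exponents! : ∀ s → Unique (map (p ℕ.*_) (exponents s n))
    map-exponents! s = Unique.map⁺ (ℕ.*-cancelˡ-≡ _ _ p) (exponents-unique s n)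

    shift : ∀ {s} e′ q → p ℕ.* n ≡ q ℕ.* (e′ ℕ.* p) → μ q ≡ s → e′ ℕ.* p ∈ map (p ℕ.*_) (exponents s n)
    shift {s} e′ q eq μq = ≡.subst (_∈ map (p ℕ.*_) (exponents s n)) (ℕ.*-comm p e′)
      (∈-map⁺ (p ℕ.*_) (∈-exponents⁺ q (ℕ.*-cancelˡ-≡ n (q ℕ.* e′) p (≡.trans eq
        (≡.trans (cong (q ℕ.*_) (ℕ.*-comm e′ p)) (x∙yz≈y∙xz q p e′)))) μq))

    unshift : ∀ {s e} → e ∈ map (p ℕ.*_) (exponents s n) → e ∈ exponents s (p ℕ.* n)
    unshift e∈ with ∈-map⁻ (p ℕ.*_) e∈
    ... | e′ , e′∈ , ≡.refl with ∈-exponents⁻ {n = n} e′∈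
    ...   | q , eq , μq = ∈-exponents⁺ q (≡.trans (cong (p ℕ.*_) eq) (x∙yz≈y∙xz p q e′)) μq

    split : ∀ {q′ e} → p ℕ.* n ≡ (q′ ℕ.* p) ℕ.* e → n ≡ q′ ℕ.* e
    split {q′} {e} eq = ℕ.*-cancelˡ-≡ n (q′ ℕ.* e) p
      (≡.trans eq (≡.trans (cong (ℕ._* e) (ℕ.*-comm q′ p)) (ℕ.*-assoc p q′ e)))

  -- Write p·n = q·e. If p ∤ e, then p ∣ q and n = (q/p)·e, so p ∣ n forces p² ∣ q and μ(q) = 0 ≠ s.
  -- Hence p ∣ e, and e/p has the same cofactor q in n.
  exponents-∣ : ∀ {s} → s ≢ + 0 → p ℕ.∣ n → exponents s (p ℕ.* n) ↭ map (p ℕ.*_) (exponents s n)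
  exponents-∣ {s} s≢0 p∣n = unique-⇔⇒↭ (exponents-unique s (p ℕ.* n)) (map-exponents! s) to unshift
    where
    to : ∀ {e} → e ∈ exponents s (p ℕ.* n) → e ∈ map (p ℕ.*_) (exponents s n)
    to {e} e∈ with ∈-exponents⁻ {n = p ℕ.* n} e∈
    ... | q , eq , μq with p ℕ.∣? e
    ...   | yes (ℕ.divides e′ ≡.refl) = shift e′ q eq μq
    ...   | no p∤e with euclidsLemma q e pr (ℕ.divides n (≡.trans (≡.sym eq) (ℕ.*-comm p n)))
    ...     | inj₂ p∣e = contradiction p∣e p∤e
    ...     | inj₁ (ℕ.divides q′ ≡.refl) with euclidsLemma q′ e pr (≡.subst (p ℕ.∣_) (split {q′} eq) p∣n)
    ...       | inj₂ p∣e  = contradiction p∣e p∤e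
    ...       | inj₁ p∣q′ = contradiction (≡.trans (≡.sym μq) (μ-square {{cofactor-nonZero {q′ ℕ.* p} {e} eq}} pr (ℕ.*-monoˡ-∣ p p∣q′))) s≢0

  -- Write p·n = q·e; p divides exactly one of q and e. If p ∣ e, then e/p has the same cofactor q
  -- in n. If p ∣ q, then e already divides n with cofactor q/p, whose μ has the opposite sign.
  exponents-∤ : ∀ {s} → ¬ p ℕ.∣ n →
    exponents s (p ℕ.* n) ↭ map (p ℕ.*_) (exponents s n) ++ exponents (ℤ.- s) n
  exponents-∤ {s} p∤n = unique-⇔⇒↭ (exponents-unique s (p ℕ.* n))
    (Unique.++⁺ (map-exponents! s) (exponents-unique (ℤ.- s) n) disjoint) to from
    where
    disjoint : ∀ {e} → ¬ (e ∈ map (p ℕ.*_) (exponents s n) × e ∈ exponents (ℤ.- s) n)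
    disjoint (e∈ , e∈′) with ∈-map⁻ (p ℕ.*_) e∈
    ... | e′ , _ , ≡.refl with ∈-exponents⁻ {n = n} e∈′
    ...   | q , eq , _ = p∤n (ℕ.∣-trans (ℕ.m∣m*n e′) (ℕ.divides q eq))

    to : ∀ {e} → e ∈ exponents s (p ℕ.* n) → e ∈ map (p ℕ.*_) (exponents s n) ++ exponents (ℤ.- s) n
    to {e} e∈ with ∈-exponents⁻ {n = p ℕ.* n} e∈
    ... | q , eq , μq with euclidsLemma q e pr (ℕ.divides n (≡.trans (≡.sym eq) (ℕ.*-comm p n)))
    ...   | inj₂ (ℕ.divides e′ ≡.refl) = ∈-++⁺ˡ (shift e′ q eq μq)
    ...   | inj₁ (ℕ.divides q′ ≡.refl) = ∈-++⁺ʳ _ (∈-exponents⁺ q′ n≡q′e (begin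
      μ q′               ≡⟨ ℤ.neg-involutive (μ q′) ⟨
      ℤ.- (ℤ.- μ q′)     ≡⟨ cong ℤ.-_ (μ-∤ pr {{q′-nonZero}} p∤q′) ⟨
      ℤ.- μ (p ℕ.* q′)   ≡⟨ cong (ℤ.-_ ∘ μ) (ℕ.*-comm p q′) ⟩
      ℤ.- μ (q′ ℕ.* p)   ≡⟨ cong ℤ.-_ μq ⟩
      ℤ.- s              ∎))
      where
      open ≡-Reasoning
      n≡q′e : n ≡ q′ ℕ.* e
      n≡q′e = split {q′} eq
      q′-nonZero : NonZero q′
      q′-nonZero = ℕ.m*n≢0⇒m≢0 q′ {n = p} {{cofactor-nonZero {q′ ℕ.* p} {e} eq}}
      p∤q′ : ¬ p ℕ.∣ q′
      p∤q′ p∣q′ = p∤n (≡.subst (p ℕ.∣_) (≡.sym n≡q′e) (ℕ.∣m⇒∣m*n e p∣q′))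

    from : ∀ {e} → e ∈ map (p ℕ.*_) (exponents s n) ++ exponents (ℤ.- s) n → e ∈ exponents s (p ℕ.* n)
    from {e} e∈ with ∈-++⁻ (map (p ℕ.*_) (exponents s n)) e∈
    ... | inj₁ e∈ˡ = unshift e∈ˡ
    ... | inj₂ e∈ʳ with ∈-exponents⁻ {n = n} e∈ʳ
    ...   | q , ≡.refl , μq = ∈-exponents⁺ (p ℕ.* q) (x∙yz≈xy∙z p q e) (begin
      μ (p ℕ.* q)      ≡⟨ μ-∤ pr {{ℕ.m*n≢0⇒m≢0 q}} (λ p∣q → p∤n (ℕ.∣m⇒∣m*n e p∣q)) ⟩
      ℤ.- μ q          ≡⟨ cong ℤ.-_ μq ⟩
      ℤ.- (ℤ.- s)      ≡⟨ ℤ.neg-involutive s ⟩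
      s                ∎)
      where open ≡-Reasoning

-- The radical

unique-primes-product-∣ : ∀ {d} ps → Unique ps → All (λ p → Prime p × p ℕ.∣ d) ps → product ps ℕ.∣ d
unique-primes-product-∣ []       []        []                = ℕ.1∣ _
unique-primes-product-∣ (p ∷ ps) (p∉ ∷ u) ((pr , p∣d) ∷ all) =
  coprime-*-∣ (prime∤⇒coprime pr λ p∣ps → All.lookup p∉
    (factorisationHasAllPrimeFactors pr p∣ps (All.map proj₁ all)) ≡.refl)
    p∣d (unique-primes-product-∣ ps u all)

rad-∣ : ∀ d → rad d ℕ.∣ d
rad-∣ d = unique-primes-product-∣ (primeDivisors d) (primeDivisors-unique d)
  (All.tabulate (∈-primeDivisors⁻ {n = d}))

rad-nonZero : ∀ d → .{{NonZero d}} → NonZero (rad d)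
rad-nonZero d = productOfPrimes≢0 (All.tabulate {xs = primeDivisors d} (proj₁ ∘ ∈-primeDivisors⁻ {n = d}))

prime∣rad : ∀ {p d} → .{{NonZero d}} → Prime p → p ℕ.∣ d → p ℕ.∣ rad d
prime∣rad {p} {d} pr p∣d = go (∈-primeDivisors⁺ pr p∣d)
  where
  go : ∀ {ps} → p ∈ ps → p ℕ.∣ foldr ℕ._*_ 1 ps
  go {_ ∷ ps} (here ≡.refl) = ℕ.m∣m*n (foldr ℕ._*_ 1 ps)
  go {x ∷ ps} (there p∈)    = ℕ.∣n⇒∣m*n x (go p∈)

-- Prime factors of e are split off one at a time; since p² ∤ e, each p is coprime to what remains.
squarefree⇒∣ : ∀ c e → .{{NonZero e}} → (∀ {p} → Prime p → ¬ p ℕ.* p ℕ.∣ e) →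
  (∀ {p} → Prime p → p ℕ.∣ e → p ℕ.∣ c) → e ℕ.∣ c
squarefree⇒∣ c = prime-induction _ (λ _ _ → ℕ.1∣ c)
  λ p n pr ih sqf primes∣c → coprime-*-∣
    (prime∤⇒coprime pr λ p∣n → sqf pr (ℕ.*-monoʳ-∣ p p∣n))
    (primes∣c pr (ℕ.m∣m*n n))
    (ih (λ pr′ q²∣n → sqf pr′ (ℕ.∣n⇒∣m*n p q²∣n)) (λ pr′ q∣n → primes∣c pr′ (ℕ.∣n⇒∣m*n p q∣n)))

squarefreeDivisors : ℕ → List ℕ
squarefreeDivisors n = filter (λ e → ¬? (μ e ℤ.≟ + 0)) (divisors n)

-- A divisor e of d with μ(e) ≠ 0 is a product of distinct primes dividing d, and all of these
-- divide `rad d`.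
squarefreeDivisors-rad : ∀ d → .{{NonZero d}} → squarefreeDivisors d ↭ squarefreeDivisors (rad d)
squarefreeDivisors-rad d = unique-⇔⇒↭ (sqf! d) (sqf! (rad d)) to from
  where
  instance
    c-nonZero : NonZero (rad d)
    c-nonZero = rad-nonZero d
  μ≢0? : ∀ e → Dec (μ e ≢ + 0)
  μ≢0? e = ¬? (μ e ℤ.≟ + 0)
  sqf! : ∀ n → Unique (squarefreeDivisors n)
  sqf! n = Unique.filter⁺ μ≢0? (divisors-unique n)
  to : ∀ {e} → e ∈ squarefreeDivisors d → e ∈ squarefreeDivisors (rad d)
  to {e} e∈ with ∈-filter⁻ μ≢0? {xs = divisors d} e∈
  ... | e∈div , μe≢0 with ∈-divisors⁻ {n = d} e∈div
  ...   | e-nonZero , e∣d = ∈-filter⁺ μ≢0? (∈-divisors⁺ (squarefree⇒∣ (rad d) e {{e-nonZero}}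
    (λ pr p²∣e → μe≢0 (μ-square {{e-nonZero}} pr p²∣e))
    (λ pr p∣e → prime∣rad pr (ℕ.∣-trans p∣e e∣d)))) μe≢0
  from : ∀ {e} → e ∈ squarefreeDivisors (rad d) → e ∈ squarefreeDivisors d
  from {e} e∈ with ∈-filter⁻ μ≢0? {xs = divisors (rad d)} e∈
  ... | e∈div , μe≢0 = ∈-filter⁺ μ≢0?
    (∈-divisors⁺ (ℕ.∣-trans (proj₂ (∈-divisors⁻ {n = rad d} e∈div)) (rad-∣ d))) μe≢0

-- The polynomial ring

-- Wrapping _≈ₚ_ in a record lets Agda infer the two polynomials.
infix 4 _≋_
record _≋_ (p q : Poly) : Set where
  constructor coeffwise
  field at : p ≈ₚ q
open _≋_

≋-isEquivalence : IsEquivalence _≋_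
≋-isEquivalence = record
  { refl  = coeffwise λ _ → ≡.refl
  ; sym   = λ e → coeffwise λ i → ≡.sym (at e i)
  ; trans = λ e f → coeffwise λ i → ≡.trans (at e i) (at f i)
  }

≋-setoid : Setoid 0ℓ 0ℓ
≋-setoid = record { isEquivalence = ≋-isEquivalence }

open IsEquivalence ≋-isEquivalence using (refl; sym; trans; reflexive)
module ≋-Reasoning = SetoidReasoning ≋-setoid

coeff-+ : ∀ p q i → coeff (p +ₚ q) i ≡ coeff p i ℚ.+ coeff q i
coeff-+ []      q       i       = ≡.sym (ℚ.+-identityˡ _)
coeff-+ (a ∷ p) []      i       = ≡.sym (ℚ.+-identityʳ _)
coeff-+ (a ∷ p) (b ∷ q) zero    = ≡.refl
coeff-+ (a ∷ p) (b ∷ q) (suc i) = coeff-+ p q i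

coeff-scale : ∀ c p i → coeff (scaleₚ c p) i ≡ c ℚ.* coeff p i
coeff-scale c []      i       = ≡.sym (ℚ.*-zeroʳ c)
coeff-scale c (a ∷ p) zero    = ≡.refl
coeff-scale c (a ∷ p) (suc i) = coeff-scale c p i

∷-cong : ∀ {a b p q} → a ≡ b → p ≋ q → a ∷ p ≋ b ∷ q
∷-cong a≡b p≋q = coeffwise λ { zero → a≡b ; (suc i) → at p≋q i }

∷-injective : ∀ {a b p q} → a ∷ p ≋ b ∷ q → a ≡ b × p ≋ q
∷-injective e = at e 0 , coeffwise λ i → at e (suc i)

0∷[] : 0ℚ ∷ [] ≋ []
0∷[] = coeffwise λ { zero → ≡.refl ; (suc i) → ≡.refl }

+-cong : ∀ {p p′ q q′} → p ≋ p′ → q ≋ q′ → p +ₚ q ≋ p′ +ₚ q′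
+-cong {p} {p′} {q} {q′} e f = coeffwise λ i →
  ≡.trans (coeff-+ p q i) (≡.trans (cong₂ ℚ._+_ (at e i) (at f i)) (≡.sym (coeff-+ p′ q′ i)))

+-congˡ : ∀ p {q q′} → q ≋ q′ → p +ₚ q ≋ p +ₚ q′
+-congˡ p = +-cong (refl {p})

+-congʳ : ∀ q {p p′} → p ≋ p′ → p +ₚ q ≋ p′ +ₚ q
+-congʳ q e = +-cong e (refl {q})

+-assoc : ∀ p q r → (p +ₚ q) +ₚ r ≋ p +ₚ (q +ₚ r)
+-assoc p q r = coeffwise λ i → begin
  coeff ((p +ₚ q) +ₚ r) i                   ≡⟨ coeff-+ (p +ₚ q) r i ⟩
  coeff (p +ₚ q) i ℚ.+ coeff r i            ≡⟨ cong (ℚ._+ _) (coeff-+ p q i) ⟩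
  (coeff p i ℚ.+ coeff q i) ℚ.+ coeff r i   ≡⟨ ℚ.+-assoc (coeff p i) (coeff q i) (coeff r i) ⟩
  coeff p i ℚ.+ (coeff q i ℚ.+ coeff r i)   ≡⟨ cong (coeff p i ℚ.+_) (coeff-+ q r i) ⟨
  coeff p i ℚ.+ coeff (q +ₚ r) i            ≡⟨ coeff-+ p (q +ₚ r) i ⟨
  coeff (p +ₚ (q +ₚ r)) i                   ∎
  where open ≡-Reasoning

+-comm : ∀ p q → p +ₚ q ≋ q +ₚ p
+-comm p q = coeffwise λ i →
  ≡.trans (coeff-+ p q i) (≡.trans (ℚ.+-comm (coeff p i) (coeff q i)) (≡.sym (coeff-+ q p i)))

+-identityʳ : ∀ p → p +ₚ [] ≋ p
+-identityʳ p = +-comm p []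

scale-cong : ∀ c {p q} → p ≋ q → scaleₚ c p ≋ scaleₚ c q
scale-cong c {p} {q} e = coeffwise λ i →
  ≡.trans (coeff-scale c p i) (≡.trans (cong (c ℚ.*_) (at e i)) (≡.sym (coeff-scale c q i)))

scale-+ : ∀ c p q → scaleₚ c (p +ₚ q) ≋ scaleₚ c p +ₚ scaleₚ c q
scale-+ c []      q       = refl
scale-+ c (a ∷ p) []      = refl
scale-+ c (a ∷ p) (b ∷ q) = ∷-cong (ℚ.*-distribˡ-+ c a b) (scale-+ c p q)

scale-scale : ∀ b c p → scaleₚ b (scaleₚ c p) ≋ scaleₚ (b ℚ.* c) p
scale-scale b c []      = refl
scale-scale b c (a ∷ p) = ∷-cong (≡.sym (ℚ.*-assoc b c a)) (scale-scale b c p)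

scale-+ʳ : ∀ b c p → scaleₚ (b ℚ.+ c) p ≋ scaleₚ b p +ₚ scaleₚ c p
scale-+ʳ b c []      = refl
scale-+ʳ b c (a ∷ p) = ∷-cong (ℚ.*-distribʳ-+ a b c) (scale-+ʳ b c p)

scale-1 : ∀ p → scaleₚ 1ℚ p ≋ p
scale-1 []      = refl
scale-1 (a ∷ p) = ∷-cong (ℚ.*-identityˡ a) (scale-1 p)

scale-0 : ∀ p → scaleₚ 0ℚ p ≋ []
scale-0 []      = refl
scale-0 (a ∷ p) = trans (∷-cong (ℚ.*-zeroˡ a) (scale-0 p)) 0∷[]

-ₚ_ : Poly → Poly
-ₚ_ = scaleₚ (ℚ.- 1ℚ)

+-inverseʳ : ∀ p → p +ₚ (-ₚ p) ≋ []
+-inverseʳ p = begin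
  p +ₚ (-ₚ p)              ≈⟨ +-congʳ (-ₚ p) (scale-1 p) ⟨
  scaleₚ 1ℚ p +ₚ (-ₚ p)    ≈⟨ scale-+ʳ 1ℚ (ℚ.- 1ℚ) p ⟨
  scaleₚ 0ℚ p              ≈⟨ scale-0 p ⟩
  []                       ∎
  where open ≋-Reasoning

+-interchange : ∀ p q r s → (p +ₚ q) +ₚ (r +ₚ s) ≋ (p +ₚ r) +ₚ (q +ₚ s)
+-interchange p q r s = coeffwise λ i → begin
  coeff ((p +ₚ q) +ₚ (r +ₚ s)) i                                ≡⟨ four p q r s i ⟩
  (coeff p i ℚ.+ coeff q i) ℚ.+ (coeff r i ℚ.+ coeff s i)       ≡⟨ ℚ-+-interchange (coeff p i) (coeff q i) (coeff r i) (coeff s i) ⟩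
  (coeff p i ℚ.+ coeff r i) ℚ.+ (coeff q i ℚ.+ coeff s i)       ≡⟨ four p r q s i ⟨
  coeff ((p +ₚ r) +ₚ (q +ₚ s)) i                                ∎
  where
  open ≡-Reasoning
  four : ∀ p q r s i → coeff ((p +ₚ q) +ₚ (r +ₚ s)) i ≡ (coeff p i ℚ.+ coeff q i) ℚ.+ (coeff r i ℚ.+ coeff s i)
  four p q r s i = ≡.trans (coeff-+ (p +ₚ q) (r +ₚ s) i) (cong₂ ℚ._+_ (coeff-+ p q i) (coeff-+ r s i))

*-congˡ : ∀ p {q q′} → q ≋ q′ → p *ₚ q ≋ p *ₚ q′
*-congˡ []      e = refl
*-congˡ (a ∷ p) e = +-cong (scale-cong a e) (∷-cong ≡.refl (*-congˡ p e))

*-zeroʳ : ∀ p → p *ₚ [] ≋ []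
*-zeroʳ []      = refl
*-zeroʳ (a ∷ p) = trans (∷-cong ≡.refl (*-zeroʳ p)) 0∷[]

-- The defining recursion of `_*ₚ_` mirrored to the right factor; commutativity and cancellation
-- both run on it.
*-∷ : ∀ p b q → p *ₚ (b ∷ q) ≋ scaleₚ b p +ₚ (0ℚ ∷ p *ₚ q)
*-∷ []      b q = sym 0∷[]
*-∷ (a ∷ p) b q = ∷-cong (cong (ℚ._+ 0ℚ) (ℚ.*-comm a b)) (begin
  scaleₚ a q +ₚ p *ₚ (b ∷ q)                       ≈⟨ +-congˡ (scaleₚ a q) (*-∷ p b q) ⟩
  scaleₚ a q +ₚ (scaleₚ b p +ₚ (0ℚ ∷ p *ₚ q))      ≈⟨ +-assoc (scaleₚ a q) (scaleₚ b p) _ ⟨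
  (scaleₚ a q +ₚ scaleₚ b p) +ₚ (0ℚ ∷ p *ₚ q)      ≈⟨ +-congʳ _ (+-comm (scaleₚ a q) (scaleₚ b p)) ⟩
  (scaleₚ b p +ₚ scaleₚ a q) +ₚ (0ℚ ∷ p *ₚ q)      ≈⟨ +-assoc (scaleₚ b p) (scaleₚ a q) _ ⟩
  scaleₚ b p +ₚ (scaleₚ a q +ₚ (0ℚ ∷ p *ₚ q))      ∎)
  where open ≋-Reasoning

*-comm : ∀ p q → p *ₚ q ≋ q *ₚ p
*-comm []      q = sym (*-zeroʳ q)
*-comm (a ∷ p) q = trans (+-congˡ (scaleₚ a q) (∷-cong ≡.refl (*-comm p q))) (sym (*-∷ q a p))

*-cong : ∀ {p p′ q q′} → p ≋ p′ → q ≋ q′ → p *ₚ q ≋ p′ *ₚ q′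
*-cong {p} {p′} {q} {q′} e f = begin
  p *ₚ q    ≈⟨ *-congˡ p f ⟩
  p *ₚ q′   ≈⟨ *-comm p q′ ⟩
  q′ *ₚ p   ≈⟨ *-congˡ q′ e ⟩
  q′ *ₚ p′  ≈⟨ *-comm q′ p′ ⟩
  p′ *ₚ q′  ∎
  where open ≋-Reasoning

*-congʳ : ∀ q {p p′} → p ≋ p′ → p *ₚ q ≋ p′ *ₚ q
*-congʳ q e = *-cong e (refl {q})

*-distribˡ-+ : ∀ p q r → p *ₚ (q +ₚ r) ≋ p *ₚ q +ₚ p *ₚ r
*-distribˡ-+ []      q r = refl
*-distribˡ-+ (a ∷ p) q r = begin
  scaleₚ a (q +ₚ r) +ₚ (0ℚ ∷ p *ₚ (q +ₚ r))
    ≈⟨ +-cong (scale-+ a q r) (∷-cong (≡.sym (ℚ.+-identityˡ 0ℚ)) (*-distribˡ-+ p q r)) ⟩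
  (scaleₚ a q +ₚ scaleₚ a r) +ₚ ((0ℚ ∷ p *ₚ q) +ₚ (0ℚ ∷ p *ₚ r))
    ≈⟨ +-interchange (scaleₚ a q) (scaleₚ a r) (0ℚ ∷ p *ₚ q) (0ℚ ∷ p *ₚ r) ⟩
  (scaleₚ a q +ₚ (0ℚ ∷ p *ₚ q)) +ₚ (scaleₚ a r +ₚ (0ℚ ∷ p *ₚ r)) ∎
  where open ≋-Reasoning

*-distribʳ-+ : ∀ r p q → (p +ₚ q) *ₚ r ≋ p *ₚ r +ₚ q *ₚ r
*-distribʳ-+ r p q = trans (*-comm (p +ₚ q) r) (trans (*-distribˡ-+ r p q) (+-cong (*-comm r p) (*-comm r q)))

scale-* : ∀ c p q → scaleₚ c p *ₚ q ≋ scaleₚ c (p *ₚ q)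
scale-* c []      q = refl
scale-* c (a ∷ p) q = begin
  scaleₚ (c ℚ.* a) q +ₚ (0ℚ ∷ scaleₚ c p *ₚ q)
    ≈⟨ +-cong (sym (scale-scale c a q)) (∷-cong (≡.sym (ℚ.*-zeroʳ c)) (scale-* c p q)) ⟩
  scaleₚ c (scaleₚ a q) +ₚ scaleₚ c (0ℚ ∷ p *ₚ q)
    ≈⟨ scale-+ c (scaleₚ a q) (0ℚ ∷ p *ₚ q) ⟨
  scaleₚ c (scaleₚ a q +ₚ (0ℚ ∷ p *ₚ q)) ∎
  where open ≋-Reasoning

0∷-* : ∀ p q → (0ℚ ∷ p) *ₚ q ≋ 0ℚ ∷ p *ₚ q
0∷-* p q = +-congʳ (0ℚ ∷ p *ₚ q) (scale-0 q)

*-assoc : ∀ p q r → (p *ₚ q) *ₚ r ≋ p *ₚ (q *ₚ r)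
*-assoc []      q r = refl
*-assoc (a ∷ p) q r = begin
  (scaleₚ a q +ₚ (0ℚ ∷ p *ₚ q)) *ₚ r
    ≈⟨ *-distribʳ-+ r (scaleₚ a q) (0ℚ ∷ p *ₚ q) ⟩
  scaleₚ a q *ₚ r +ₚ (0ℚ ∷ p *ₚ q) *ₚ r
    ≈⟨ +-cong (scale-* a q r) (trans (0∷-* (p *ₚ q) r) (∷-cong ≡.refl (*-assoc p q r))) ⟩
  scaleₚ a (q *ₚ r) +ₚ (0ℚ ∷ p *ₚ (q *ₚ r)) ∎
  where open ≋-Reasoning

1ₚ : Poly
1ₚ = 1ℚ ∷ []

const-* : ∀ c p → (c ∷ []) *ₚ p ≋ scaleₚ c p
const-* c p = trans (+-congˡ (scaleₚ c p) 0∷[]) (+-identityʳ (scaleₚ c p))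

*-identityˡ : ∀ p → 1ₚ *ₚ p ≋ p
*-identityˡ p = trans (const-* 1ℚ p) (scale-1 p)

*-identityʳ : ∀ p → p *ₚ 1ₚ ≋ p
*-identityʳ p = trans (*-comm p 1ₚ) (*-identityˡ p)

polyRing : CommutativeRing 0ℓ 0ℓ
polyRing = record
  { Carrier = Poly ; _≈_ = _≋_ ; _+_ = _+ₚ_ ; _*_ = _*ₚ_ ; -_ = -ₚ_ ; 0# = [] ; 1# = 1ₚ
  ; isCommutativeRing = record
    { isRing = record
      { +-isAbelianGroup = record
        { isGroup = record
          { isMonoid = record
            { isSemigroup = record
              { isMagma = record { isEquivalence = ≋-isEquivalence ; ∙-cong = +-cong }
              ; assoc = +-assoc }
            ; identity = (λ _ → refl) , +-identityʳ }
          ; inverse = (λ p → trans (+-comm (-ₚ p) p) (+-inverseʳ p)) , +-inverseʳ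
          ; ⁻¹-cong = scale-cong (ℚ.- 1ℚ) }
        ; comm = +-comm }
      ; *-cong = *-cong
      ; *-assoc = *-assoc
      ; *-identity = *-identityˡ , *-identityʳ
      ; distrib = *-distribˡ-+ , *-distribʳ-+ }
    ; *-comm = *-comm }
  }

open import Algebra.Properties.CommutativeSemigroup (CommutativeRing.*-commutativeSemigroup polyRing) using () renaming (interchange to *-interchange)
open import Algebra.Solver.Ring.NaturalCoefficients.Default (CommutativeRing.commutativeSemiring polyRing) using (solve; _:=_; _:+_; _:*_)

-- Divisibility and cancellation

infix 4 _∣_
record _∣_ (p q : Poly) : Set where
  constructor divides
  field
    cofactor   : Poly
    isCofactor : q ≋ p *ₚ cofactor

∣-trans : ∀ {p q r} → p ∣ q → q ∣ r → p ∣ r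
∣-trans {p} (divides s q≋ps) (divides t r≋qt) = divides (s *ₚ t) (trans r≋qt (trans (*-congʳ t q≋ps) (*-assoc p s t)))

∣-resp : ∀ {p p′ q q′} → p ≋ p′ → q ≋ q′ → p ∣ q → p′ ∣ q′
∣-resp p≋p′ q≋q′ (divides r q≋pr) = divides r (trans (sym q≋q′) (trans q≋pr (*-congʳ r p≋p′)))

∣-scale : ∀ c {p q} → p ∣ q → p ∣ scaleₚ c q
∣-scale c {p} {q} (divides r e) = divides (scaleₚ c r) (begin
  scaleₚ c q             ≈⟨ scale-cong c e ⟩
  scaleₚ c (p *ₚ r)      ≈⟨ scale-cong c (*-comm p r) ⟩
  scaleₚ c (r *ₚ p)      ≈⟨ scale-* c r p ⟨
  scaleₚ c r *ₚ p        ≈⟨ *-comm (scaleₚ c r) p ⟩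
  p *ₚ scaleₚ c r        ∎)
  where open ≋-Reasoning

∣-+ : ∀ {p q r} → p ∣ q → p ∣ r → p ∣ q +ₚ r
∣-+ {p} (divides s e) (divides t f) = divides (s +ₚ t) (trans (+-cong e f) (sym (*-distribˡ-+ p s t)))

∣-* : ∀ {p q r s} → p ∣ q → r ∣ s → p *ₚ r ∣ q *ₚ s
∣-* {p} {q} {r} {s} (divides t e) (divides u f) = divides (t *ₚ u) (trans (*-cong e f) (*-interchange p t r u))

coeff-*-0 : ∀ p q → coeff (p *ₚ q) 0 ≡ coeff p 0 ℚ.* coeff q 0
coeff-*-0 []      q = ≡.sym (ℚ.*-zeroˡ (coeff q 0))
coeff-*-0 (a ∷ p) q = ≡.trans (coeff-+ (scaleₚ a q) _ 0)
  (≡.trans (ℚ.+-identityʳ _) (coeff-scale a q 0))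

-- Divisors of xⁿ − 1 do not vanish at 0, which makes them cancellable.
NonZeroAt0 : Poly → Set
NonZeroAt0 p = coeff p 0 ≢ 0ℚ

nonZeroAt0-∣ : ∀ {p q} → p ∣ q → NonZeroAt0 q → NonZeroAt0 p
nonZeroAt0-∣ {p} {q} (divides r e) q0≢0 p0≡0 = q0≢0 (begin
  coeff q 0                ≡⟨ at e 0 ⟩
  coeff (p *ₚ r) 0         ≡⟨ coeff-*-0 p r ⟩
  coeff p 0 ℚ.* coeff r 0  ≡⟨ cong (ℚ._* coeff r 0) p0≡0 ⟩
  0ℚ ℚ.* coeff r 0         ≡⟨ ℚ.*-zeroˡ (coeff r 0) ⟩
  0ℚ                       ∎)
  where open ≡-Reasoning

ℚ-noZeroDivisor : ∀ {a b} → a ≢ 0ℚ → b ℚ.* a ≡ 0ℚ → b ≡ 0ℚ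
ℚ-noZeroDivisor {a} {b} a≢0 ba≡0 = begin
  b                       ≡⟨ ℚ.*-identityʳ b ⟨
  b ℚ.* 1ℚ                ≡⟨ cong (b ℚ.*_) (ℚ.*-inverseʳ a) ⟨
  b ℚ.* (a ℚ.* (ℚ.1/ a))  ≡⟨ ℚ.*-assoc b a (ℚ.1/ a) ⟨
  (b ℚ.* a) ℚ.* (ℚ.1/ a)  ≡⟨ cong (ℚ._* (ℚ.1/ a)) ba≡0 ⟩
  0ℚ ℚ.* (ℚ.1/ a)         ≡⟨ ℚ.*-zeroˡ (ℚ.1/ a) ⟩
  0ℚ                      ∎
  where
  open ≡-Reasoning
  instance a-nonZero = ℚ.≢-nonZero a≢0

nonZeroAt0-* : ∀ p q → NonZeroAt0 p → NonZeroAt0 q → NonZeroAt0 (p *ₚ q)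
nonZeroAt0-* p q p0≢0 q0≢0 pq0≡0 =
  p0≢0 (ℚ-noZeroDivisor q0≢0 (≡.trans (≡.sym (coeff-*-0 p q)) pq0≡0))

-- The constant term of the product is b·p(0), which forces b = 0; dividing by x leaves the same
-- equation for a shorter list. Starting at the lowest coefficient makes trailing zeros harmless.
*-zero-cancelˡ : ∀ p q → NonZeroAt0 p → p *ₚ q ≋ [] → q ≋ []
*-zero-cancelˡ p []      p0≢0 e = refl
*-zero-cancelˡ p (b ∷ q) p0≢0 e = trans (∷-cong b≡0 q≋[]) 0∷[]
  where
  open ≡-Reasoning
  expanded : scaleₚ b p +ₚ (0ℚ ∷ p *ₚ q) ≋ []
  expanded = trans (sym (*-∷ p b q)) e
  b≡0 : b ≡ 0ℚ
  b≡0 = ℚ-noZeroDivisor p0≢0 (begin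
    b ℚ.* coeff p 0                            ≡⟨ coeff-scale b p 0 ⟨
    coeff (scaleₚ b p) 0                       ≡⟨ ℚ.+-identityʳ _ ⟨
    coeff (scaleₚ b p) 0 ℚ.+ 0ℚ                ≡⟨ coeff-+ (scaleₚ b p) (0ℚ ∷ p *ₚ q) 0 ⟨
    coeff (scaleₚ b p +ₚ (0ℚ ∷ p *ₚ q)) 0      ≡⟨ at expanded 0 ⟩
    0ℚ                                         ∎)
  tail≋[] : 0ℚ ∷ p *ₚ q ≋ []
  tail≋[] = trans (+-congʳ (0ℚ ∷ p *ₚ q) (sym (trans (reflexive (cong (λ c → scaleₚ c p) b≡0)) (scale-0 p)))) expanded
  q≋[] : q ≋ []
  q≋[] = *-zero-cancelˡ p q p0≢0 (coeffwise λ i → at tail≋[] (suc i))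

*-cancelˡ : ∀ p {q r} → NonZeroAt0 p → p *ₚ q ≋ p *ₚ r → q ≋ r
*-cancelˡ p {q} {r} p0≢0 e = begin
  q                      ≈⟨ +-identityʳ q ⟨
  q +ₚ []                ≈⟨ +-congˡ q (trans (+-comm (-ₚ r) r) (+-inverseʳ r)) ⟨
  q +ₚ ((-ₚ r) +ₚ r)     ≈⟨ +-assoc q (-ₚ r) r ⟨
  (q +ₚ (-ₚ r)) +ₚ r     ≈⟨ +-congʳ r (*-zero-cancelˡ p (q +ₚ (-ₚ r)) p0≢0 difference) ⟩
  r                      ∎
  where
  open ≋-Reasoning
  difference : p *ₚ (q +ₚ (-ₚ r)) ≋ []
  difference = begin
    p *ₚ (q +ₚ (-ₚ r))          ≈⟨ *-distribˡ-+ p q (-ₚ r) ⟩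
    p *ₚ q +ₚ p *ₚ (-ₚ r)       ≈⟨ +-congʳ _ e ⟩
    p *ₚ r +ₚ p *ₚ (-ₚ r)       ≈⟨ *-distribˡ-+ p r (-ₚ r) ⟨
    p *ₚ (r +ₚ (-ₚ r))          ≈⟨ *-congˡ p (+-inverseʳ r) ⟩
    p *ₚ []                     ≈⟨ *-zeroʳ p ⟩
    []                          ∎

*-cancelʳ : ∀ p {q r} → NonZeroAt0 p → q *ₚ p ≋ r *ₚ p → q ≋ r
*-cancelʳ p {q} {r} p0≢0 e = *-cancelˡ p p0≢0 (trans (*-comm p q) (trans e (*-comm r p)))

-- Substitution

-- Horner evaluation at t. `expand k` is the case t = xᵏ, so its ring laws and its iteration are
-- instances of facts valid for every t.
compose : Poly → Poly → Poly
compose t []      = []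
compose t (a ∷ p) = (a ∷ []) +ₚ t *ₚ compose t p

compose-zero : ∀ t p → p ≋ [] → compose t p ≋ []
compose-zero t []      e = refl
compose-zero t (a ∷ p) e = begin
  (a ∷ []) +ₚ t *ₚ compose t p  ≈⟨ +-cong (∷-cong (at e 0) (refl {[]})) (*-congˡ t (compose-zero t p (coeffwise (at e ∘ suc)))) ⟩
  (0ℚ ∷ []) +ₚ t *ₚ []          ≈⟨ +-cong 0∷[] (*-zeroʳ t) ⟩
  []                            ∎
  where open ≋-Reasoning

compose-cong : ∀ t p q → p ≋ q → compose t p ≋ compose t q
compose-cong t []      q       e = sym (compose-zero t q (sym e))
compose-cong t (a ∷ p) []      e = compose-zero t (a ∷ p) e
compose-cong t (a ∷ p) (b ∷ q) e =
  let a≡b , p≋q = ∷-injective e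
  in +-cong (∷-cong a≡b (refl {[]})) (*-congˡ t (compose-cong t p q p≋q))

compose-congˡ : ∀ {s t} p → s ≋ t → compose s p ≋ compose t p
compose-congˡ []      e = refl
compose-congˡ (a ∷ p) e = +-congˡ (a ∷ []) (*-cong e (compose-congˡ p e))

compose-+ : ∀ t p q → compose t (p +ₚ q) ≋ compose t p +ₚ compose t q
compose-+ t []      q       = refl
compose-+ t (a ∷ p) []      = sym (+-identityʳ _)
compose-+ t (a ∷ p) (b ∷ q) = begin
  ((a ∷ []) +ₚ (b ∷ [])) +ₚ t *ₚ compose t (p +ₚ q)
    ≈⟨ +-congˡ ((a ℚ.+ b) ∷ []) (trans (*-congˡ t (compose-+ t p q)) (*-distribˡ-+ t _ _)) ⟩
  ((a ∷ []) +ₚ (b ∷ [])) +ₚ (t *ₚ compose t p +ₚ t *ₚ compose t q)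
    ≈⟨ +-interchange (a ∷ []) (b ∷ []) (t *ₚ compose t p) (t *ₚ compose t q) ⟩
  compose t (a ∷ p) +ₚ compose t (b ∷ q) ∎
  where open ≋-Reasoning

compose-scale : ∀ t c p → compose t (scaleₚ c p) ≋ scaleₚ c (compose t p)
compose-scale t c []      = refl
compose-scale t c (a ∷ p) = begin
  scaleₚ c (a ∷ []) +ₚ t *ₚ compose t (scaleₚ c p)
    ≈⟨ +-congˡ (scaleₚ c (a ∷ [])) (*-congˡ t (compose-scale t c p)) ⟩
  scaleₚ c (a ∷ []) +ₚ t *ₚ scaleₚ c (compose t p)
    ≈⟨ +-congˡ (scaleₚ c (a ∷ [])) (trans (*-comm t _) (trans (scale-* c (compose t p) t) (scale-cong c (*-comm (compose t p) t)))) ⟩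
  scaleₚ c (a ∷ []) +ₚ scaleₚ c (t *ₚ compose t p)
    ≈⟨ scale-+ c (a ∷ []) (t *ₚ compose t p) ⟨
  scaleₚ c (compose t (a ∷ p)) ∎
  where open ≋-Reasoning

compose-0∷ : ∀ t p → compose t (0ℚ ∷ p) ≋ t *ₚ compose t p
compose-0∷ t p = +-congʳ (t *ₚ compose t p) 0∷[]

compose-* : ∀ t p q → compose t (p *ₚ q) ≋ compose t p *ₚ compose t q
compose-* t []      q = refl
compose-* t (a ∷ p) q = begin
  compose t (scaleₚ a q +ₚ (0ℚ ∷ p *ₚ q))
    ≈⟨ compose-+ t (scaleₚ a q) (0ℚ ∷ p *ₚ q) ⟩
  compose t (scaleₚ a q) +ₚ compose t (0ℚ ∷ p *ₚ q)
    ≈⟨ +-cong (trans (compose-scale t a q) (sym (const-* a (compose t q)))) (compose-0∷ t (p *ₚ q)) ⟩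
  (a ∷ []) *ₚ compose t q +ₚ t *ₚ compose t (p *ₚ q)
    ≈⟨ +-congˡ _ (trans (*-congˡ t (compose-* t p q)) (sym (*-assoc t _ _))) ⟩
  (a ∷ []) *ₚ compose t q +ₚ (t *ₚ compose t p) *ₚ compose t q
    ≈⟨ *-distribʳ-+ (compose t q) (a ∷ []) (t *ₚ compose t p) ⟨
  compose t (a ∷ p) *ₚ compose t q ∎
  where open ≋-Reasoning

compose-const : ∀ t a → compose t (a ∷ []) ≋ a ∷ []
compose-const t a = trans (+-congˡ (a ∷ []) (*-zeroʳ t)) (+-identityʳ (a ∷ []))

compose-assoc : ∀ t s p → compose t (compose s p) ≋ compose (compose t s) p
compose-assoc t s []      = refl
compose-assoc t s (a ∷ p) = begin
  compose t ((a ∷ []) +ₚ s *ₚ compose s p)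
    ≈⟨ compose-+ t (a ∷ []) (s *ₚ compose s p) ⟩
  compose t (a ∷ []) +ₚ compose t (s *ₚ compose s p)
    ≈⟨ +-cong (compose-const t a) (trans (compose-* t s (compose s p)) (*-congˡ (compose t s) (compose-assoc t s p))) ⟩
  compose (compose t s) (a ∷ p) ∎
  where open ≋-Reasoning

expand≡compose : ∀ k p → expand k p ≡ compose (monomial k 1ℚ) p
expand≡compose k []      = ≡.refl
expand≡compose k (a ∷ p) = cong (λ q → (a ∷ []) +ₚ monomial k 1ℚ *ₚ q) (expand≡compose k p)

monomial-* : ∀ j k c → monomial j 1ℚ *ₚ monomial k c ≋ monomial (j ℕ.+ k) c
monomial-* zero    k c = *-identityˡ (monomial k c)
monomial-* (suc j) k c = trans (0∷-* (monomial j 1ℚ) (monomial k c)) (∷-cong ≡.refl (monomial-* j k c))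

coeff-monomial-* : ∀ k p i → coeff (monomial k 1ℚ *ₚ p) (k ℕ.+ i) ≡ coeff p i
coeff-monomial-* zero    p i = at (*-identityˡ p) i
coeff-monomial-* (suc k) p i = ≡.trans (at (0∷-* (monomial k 1ℚ) p) (suc k ℕ.+ i)) (coeff-monomial-* k p i)

compose-monomial : ∀ j k c → compose (monomial j 1ℚ) (monomial k c) ≋ monomial (j ℕ.* k) c
compose-monomial j zero    c = trans (compose-const (monomial j 1ℚ) c) (reflexive (cong (λ n → monomial n c) (≡.sym (ℕ.*-zeroʳ j))))
compose-monomial j (suc k) c = begin
  compose X (0ℚ ∷ monomial k c)   ≈⟨ compose-0∷ X (monomial k c) ⟩
  X *ₚ compose X (monomial k c)   ≈⟨ *-congˡ X (compose-monomial j k c) ⟩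
  X *ₚ monomial (j ℕ.* k) c       ≈⟨ monomial-* j (j ℕ.* k) c ⟩
  monomial (j ℕ.+ j ℕ.* k) c      ≡⟨ cong (λ n → monomial n c) (ℕ.*-suc j k) ⟨
  monomial (j ℕ.* suc k) c        ∎
  where
  open ≋-Reasoning
  X = monomial j 1ℚ

expand-cong : ∀ k {p q} → p ≋ q → expand k p ≋ expand k q
expand-cong k {p} {q} e rewrite expand≡compose k p | expand≡compose k q = compose-cong _ p q e

expand-+ : ∀ k p q → expand k (p +ₚ q) ≋ expand k p +ₚ expand k q
expand-+ k p q rewrite expand≡compose k p | expand≡compose k q | expand≡compose k (p +ₚ q) = compose-+ _ p q

expand-scale : ∀ k c p → expand k (scaleₚ c p) ≋ scaleₚ c (expand k p)
expand-scale k c p rewrite expand≡compose k p | expand≡compose k (scaleₚ c p) = compose-scale _ c p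

expand-* : ∀ k p q → expand k (p *ₚ q) ≋ expand k p *ₚ expand k q
expand-* k p q rewrite expand≡compose k p | expand≡compose k q | expand≡compose k (p *ₚ q) = compose-* _ p q

expand-const : ∀ k a → expand k (a ∷ []) ≋ a ∷ []
expand-const k a = compose-const (monomial k 1ℚ) a

expand-monomial : ∀ j k c → expand j (monomial k c) ≋ monomial (j ℕ.* k) c
expand-monomial j k c rewrite expand≡compose j (monomial k c) = compose-monomial j k c

expand-expand : ∀ j k p → expand j (expand k p) ≋ expand (j ℕ.* k) p
expand-expand j k p rewrite expand≡compose k p | expand≡compose j (compose (monomial k 1ℚ) p) | expand≡compose (j ℕ.* k) p =
  trans (compose-assoc (monomial j 1ℚ) (monomial k 1ℚ) p) (compose-congˡ p (compose-monomial j k 1ℚ))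

expand-expand-comm : ∀ j k p → expand j (expand k p) ≋ expand k (expand j p)
expand-expand-comm j k p = trans (expand-expand j k p)
  (trans (reflexive (cong (λ n → expand n p) (ℕ.*-comm j k))) (sym (expand-expand k j p)))

expand-1 : ∀ p → expand 1 p ≋ p
expand-1 []      = refl
expand-1 (a ∷ p) = begin
  (a ∷ []) +ₚ monomial 1 1ℚ *ₚ expand 1 p   ≈⟨ +-congˡ (a ∷ []) (trans (0∷-* 1ₚ (expand 1 p)) (∷-cong ≡.refl (trans (*-identityˡ _) (expand-1 p)))) ⟩
  (a ∷ []) +ₚ (0ℚ ∷ p)                      ≈⟨ ∷-cong (ℚ.+-identityʳ a) refl ⟩
  a ∷ p                                     ∎
  where open ≋-Reasoning

expand-∣ : ∀ k {p q} → p ∣ q → expand k p ∣ expand k q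
expand-∣ k {p} (divides r e) = divides (expand k r) (trans (expand-cong k e) (expand-* k p r))

expand-xPowMinusOne : ∀ j k → expand j (xPowMinusOne k) ≋ xPowMinusOne (j ℕ.* k)
expand-xPowMinusOne j k = trans (expand-+ j (monomial k 1ℚ) (ℚ.- 1ℚ ∷ []))
  (+-cong (expand-monomial j k 1ℚ) (expand-const j (ℚ.- 1ℚ)))

coeff-expand-0 : ∀ k .{{_ : NonZero k}} p → coeff (expand k p) 0 ≡ coeff p 0
coeff-expand-0 k       []      = ≡.refl
coeff-expand-0 (suc k) (a ∷ p) = begin
  coeff ((a ∷ []) +ₚ X *ₚ expand (suc k) p) 0     ≡⟨ coeff-+ (a ∷ []) (X *ₚ expand (suc k) p) 0 ⟩
  a ℚ.+ coeff (X *ₚ expand (suc k) p) 0           ≡⟨ cong (a ℚ.+_) (at (0∷-* (monomial k 1ℚ) (expand (suc k) p)) 0) ⟩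
  a ℚ.+ 0ℚ                                        ≡⟨ ℚ.+-identityʳ a ⟩
  a                                               ∎
  where
  open ≡-Reasoning
  X = monomial (suc k) 1ℚ

nonZeroAt0-expand : ∀ k .{{_ : NonZero k}} {p} → NonZeroAt0 p → NonZeroAt0 (expand k p)
nonZeroAt0-expand k {p} p0≢0 e = p0≢0 (≡.trans (≡.sym (coeff-expand-0 k p)) e)

coeff-monomial-≢ : ∀ n i c → n ≢ i → coeff (monomial n c) i ≡ 0ℚ
coeff-monomial-≢ zero    zero    c n≢i = contradiction ≡.refl n≢i
coeff-monomial-≢ zero    (suc i) c n≢i = ≡.refl
coeff-monomial-≢ (suc n) zero    c n≢i = ≡.refl
coeff-monomial-≢ (suc n) (suc i) c n≢i = coeff-monomial-≢ n i c (n≢i ∘ cong suc)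

-- The coefficients at multiples of k

coeff-applyUpTo : ∀ (g : ℕ → ℚ) n → (∀ i → n ℕ.≤ i → g i ≡ 0ℚ) → ∀ i → coeff (applyUpTo g n) i ≡ g i
coeff-applyUpTo g zero    g≡0 i       = ≡.sym (g≡0 i z≤n)
coeff-applyUpTo g (suc n) g≡0 zero    = ≡.refl
coeff-applyUpTo g (suc n) g≡0 (suc i) = coeff-applyUpTo (g ∘ suc) n (λ i → g≡0 (suc i) ∘ s≤s) i

coeff-≥length : ∀ p i → length p ℕ.≤ i → coeff p i ≡ 0ℚ
coeff-≥length []      i       _       = ≡.refl
coeff-≥length (a ∷ p) (suc i) (s≤s h) = coeff-≥length p i h

-- A linear left inverse of `expand k`. The length of p is long enough because k·i ≥ i for k ≥ 1;
-- surplus entries are zeros.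
section : ℕ → Poly → Poly
section k p = applyUpTo (λ i → coeff p (k ℕ.* i)) (length p)

module _ (k : ℕ) .{{_ : NonZero k}} where

  coeff-section : ∀ p i → coeff (section k p) i ≡ coeff p (k ℕ.* i)
  coeff-section p = coeff-applyUpTo _ (length p)
    (λ i len≤i → coeff-≥length p (k ℕ.* i) (ℕ.≤-trans len≤i (ℕ.m≤n*m i k)))

  section-cong : ∀ {p q} → p ≋ q → section k p ≋ section k q
  section-cong {p} {q} e = coeffwise λ i →
    ≡.trans (coeff-section p i) (≡.trans (at e (k ℕ.* i)) (≡.sym (coeff-section q i)))

  section-+ : ∀ p q → section k (p +ₚ q) ≋ section k p +ₚ section k q
  section-+ p q = coeffwise λ i → begin
    coeff (section k (p +ₚ q)) i                      ≡⟨ coeff-section (p +ₚ q) i ⟩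
    coeff (p +ₚ q) (k ℕ.* i)                          ≡⟨ coeff-+ p q (k ℕ.* i) ⟩
    coeff p (k ℕ.* i) ℚ.+ coeff q (k ℕ.* i)           ≡⟨ cong₂ ℚ._+_ (coeff-section p i) (coeff-section q i) ⟨
    coeff (section k p) i ℚ.+ coeff (section k q) i   ≡⟨ coeff-+ (section k p) (section k q) i ⟨
    coeff (section k p +ₚ section k q) i              ∎
    where open ≡-Reasoning

  section-scale : ∀ c p → section k (scaleₚ c p) ≋ scaleₚ c (section k p)
  section-scale c p = coeffwise λ i → begin
    coeff (section k (scaleₚ c p)) i     ≡⟨ coeff-section (scaleₚ c p) i ⟩
    coeff (scaleₚ c p) (k ℕ.* i)         ≡⟨ coeff-scale c p (k ℕ.* i) ⟩
    c ℚ.* coeff p (k ℕ.* i)              ≡⟨ cong (c ℚ.*_) (coeff-section p i) ⟨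
    c ℚ.* coeff (section k p) i          ≡⟨ coeff-scale c (section k p) i ⟨
    coeff (scaleₚ c (section k p)) i     ∎
    where open ≡-Reasoning

  section-shift : ∀ p → section k (monomial k 1ℚ *ₚ p) ≋ 0ℚ ∷ section k p
  section-shift p = coeffwise λ { zero → low ; (suc i) → high i }
    where
    open ≡-Reasoning
    low : coeff (section k (monomial k 1ℚ *ₚ p)) 0 ≡ 0ℚ
    low = begin
      coeff (section k (monomial k 1ℚ *ₚ p)) 0     ≡⟨ coeff-section (monomial k 1ℚ *ₚ p) 0 ⟩
      coeff (monomial k 1ℚ *ₚ p) (k ℕ.* 0)         ≡⟨ cong (coeff (monomial k 1ℚ *ₚ p)) (ℕ.*-zeroʳ k) ⟩
      coeff (monomial k 1ℚ *ₚ p) 0                 ≡⟨ coeff-*-0 (monomial k 1ℚ) p ⟩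
      coeff (monomial k 1ℚ) 0 ℚ.* coeff p 0        ≡⟨ cong (ℚ._* coeff p 0) (coeff-monomial-≢ k 0 1ℚ (ℕ.≢-nonZero⁻¹ k)) ⟩
      0ℚ ℚ.* coeff p 0                             ≡⟨ ℚ.*-zeroˡ (coeff p 0) ⟩
      0ℚ                                           ∎
    high : ∀ i → coeff (section k (monomial k 1ℚ *ₚ p)) (suc i) ≡ coeff (section k p) i
    high i = begin
      coeff (section k (monomial k 1ℚ *ₚ p)) (suc i)     ≡⟨ coeff-section (monomial k 1ℚ *ₚ p) (suc i) ⟩
      coeff (monomial k 1ℚ *ₚ p) (k ℕ.* suc i)           ≡⟨ cong (coeff (monomial k 1ℚ *ₚ p)) (ℕ.*-suc k i) ⟩
      coeff (monomial k 1ℚ *ₚ p) (k ℕ.+ k ℕ.* i)         ≡⟨ coeff-monomial-* k p (k ℕ.* i) ⟩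
      coeff p (k ℕ.* i)                                  ≡⟨ coeff-section p i ⟨
      coeff (section k p) i                              ∎

  -- Projection formula: multiplying by xᵏ moves the selected coefficients by exactly one place, so
  -- `section k` is linear over the polynomials in xᵏ.
  section-expand-* : ∀ p q → section k (expand k p *ₚ q) ≋ p *ₚ section k q
  section-expand-* []      q = refl
  section-expand-* (a ∷ p) q = begin
    section k (((a ∷ []) +ₚ X *ₚ expand k p) *ₚ q)
      ≈⟨ section-cong (trans (*-distribʳ-+ q (a ∷ []) (X *ₚ expand k p)) (+-cong (const-* a q) (*-assoc X (expand k p) q))) ⟩
    section k (scaleₚ a q +ₚ X *ₚ (expand k p *ₚ q))
      ≈⟨ section-+ (scaleₚ a q) (X *ₚ (expand k p *ₚ q)) ⟩
    section k (scaleₚ a q) +ₚ section k (X *ₚ (expand k p *ₚ q))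
      ≈⟨ +-cong (section-scale a q) (trans (section-shift (expand k p *ₚ q)) (∷-cong ≡.refl (section-expand-* p q))) ⟩
    scaleₚ a (section k q) +ₚ (0ℚ ∷ p *ₚ section k q) ∎
    where
    open ≋-Reasoning
    X = monomial k 1ℚ

  -- Applying `section k` to the divisibility strips both expansions and leaves p ∣ c·f with c
  -- invertible. The multiplier g makes room for a factor that is needed on the expanded side and
  -- becomes a constant after `section k`.
  expand-reflects-∣ : ∀ c {p f g} → section k g ≋ c ∷ [] → c ≢ 0ℚ → expand k p ∣ expand k f *ₚ g → p ∣ f
  expand-reflects-∣ c {p} {f} {g} sg≋c c≢0 (divides r e) =
    ∣-resp refl scaled (∣-scale (ℚ.1/ c) (divides (section k r) (begin
      scaleₚ c f                        ≈⟨ const-* c f ⟨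
      (c ∷ []) *ₚ f                     ≈⟨ *-comm (c ∷ []) f ⟩
      f *ₚ (c ∷ [])                     ≈⟨ *-congˡ f sg≋c ⟨
      f *ₚ section k g                  ≈⟨ section-expand-* f g ⟨
      section k (expand k f *ₚ g)       ≈⟨ section-cong e ⟩
      section k (expand k p *ₚ r)       ≈⟨ section-expand-* p r ⟩
      p *ₚ section k r                  ∎)))
    where
    open ≋-Reasoning
    instance c-nonZero = ℚ.≢-nonZero c≢0
    scaled : scaleₚ (ℚ.1/ c) (scaleₚ c f) ≋ f
    scaled = trans (scale-scale (ℚ.1/ c) c f)
      (trans (reflexive (cong (λ b → scaleₚ b f) (ℚ.*-inverseˡ c))) (scale-1 f))

section-const : ∀ k a → section k (a ∷ []) ≋ a ∷ []
section-const k a = ∷-cong (cong (coeff (a ∷ [])) (ℕ.*-zeroʳ k)) refl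

section-xPowMinusOne : ∀ k .{{_ : NonZero k}} n → ¬ (k ℕ.∣ n) → section k (xPowMinusOne n) ≋ ℚ.- 1ℚ ∷ []
section-xPowMinusOne k n k∤n = trans (section-+ k (monomial n 1ℚ) (ℚ.- 1ℚ ∷ []))
  (+-cong {p′ = []} (coeffwise λ i → ≡.trans (coeff-section k (monomial n 1ℚ) i)
    (coeff-monomial-≢ n (k ℕ.* i) 1ℚ λ n≡ki → k∤n (ℕ.divides i (≡.trans n≡ki (ℕ.*-comm k i)))))
    (section-const k (ℚ.- 1ℚ)))

-- Comaximality

-- Bézout form of coprimality: it passes to factors, survives substitution, and yields Euclid's
-- lemma by direct calculation.
Comaximal : Poly → Poly → Set
Comaximal p q = ∃₂ λ a b → a *ₚ p +ₚ b *ₚ q ≋ 1ₚ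

comaximal-sym : ∀ {p q} → Comaximal p q → Comaximal q p
comaximal-sym {p} {q} (a , b , e) = b , a , trans (+-comm (b *ₚ q) (a *ₚ p)) e

comaximal-cong : ∀ {p p′ q q′} → p ≋ p′ → q ≋ q′ → Comaximal p q → Comaximal p′ q′
comaximal-cong p≋p′ q≋q′ (a , b , e) =
  a , b , trans (+-cong (*-congˡ a (sym p≋p′)) (*-congˡ b (sym q≋q′))) e

comaximal-factor : ∀ {p p′ q q′} → p′ ∣ p → q′ ∣ q → Comaximal p q → Comaximal p′ q′
comaximal-factor {p} {p′} {q} {q′} (divides r p≋) (divides s q≋) (a , b , e) = a *ₚ r , b *ₚ s , (begin
  (a *ₚ r) *ₚ p′ +ₚ (b *ₚ s) *ₚ q′
    ≈⟨ solve 6 (λ a r p b s q → (a :* r) :* p :+ (b :* s) :* q := a :* (p :* r) :+ b :* (q :* s)) refl a r p′ b s q′ ⟩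
  a *ₚ (p′ *ₚ r) +ₚ b *ₚ (q′ *ₚ s)
    ≈⟨ +-cong (*-congˡ a p≋) (*-congˡ b q≋) ⟨
  a *ₚ p +ₚ b *ₚ q
    ≈⟨ e ⟩
  1ₚ ∎)
  where open ≋-Reasoning

comaximal-expand : ∀ k {p q} → Comaximal p q → Comaximal (expand k p) (expand k q)
comaximal-expand k {p} {q} (a , b , e) = expand k a , expand k b , (begin
  expand k a *ₚ expand k p +ₚ expand k b *ₚ expand k q  ≈⟨ +-cong (expand-* k a p) (expand-* k b q) ⟨
  expand k (a *ₚ p) +ₚ expand k (b *ₚ q)                ≈⟨ expand-+ k (a *ₚ p) (b *ₚ q) ⟨
  expand k (a *ₚ p +ₚ b *ₚ q)                           ≈⟨ expand-cong k e ⟩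
  expand k 1ₚ                                           ≈⟨ expand-const k 1ℚ ⟩
  1ₚ                                                    ∎)
  where open ≋-Reasoning

comaximal-∣ : ∀ {p q r} → Comaximal p q → p ∣ r *ₚ q → p ∣ r
comaximal-∣ {p} {q} {r} (a , b , e) (divides s rq≋ps) = divides (r *ₚ a +ₚ b *ₚ s) (begin
  r                                  ≈⟨ *-identityʳ r ⟨
  r *ₚ 1ₚ                            ≈⟨ *-congˡ r e ⟨
  r *ₚ (a *ₚ p +ₚ b *ₚ q)            ≈⟨ solve 5 (λ r a p b q → r :* (a :* p :+ b :* q) := p :* (r :* a) :+ b :* (r :* q)) refl r a p b q ⟩
  p *ₚ (r *ₚ a) +ₚ b *ₚ (r *ₚ q)     ≈⟨ +-congˡ _ (*-congˡ b rq≋ps) ⟩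
  p *ₚ (r *ₚ a) +ₚ b *ₚ (p *ₚ s)     ≈⟨ solve 5 (λ p r a b s → p :* (r :* a) :+ b :* (p :* s) := p :* (r :* a :+ b :* s)) refl p r a b s ⟩
  p *ₚ (r *ₚ a +ₚ b *ₚ s)            ∎)
  where open ≋-Reasoning

+-cancel-neg : ∀ p q → (p +ₚ q) +ₚ (-ₚ q) ≋ p
+-cancel-neg p q = trans (+-assoc p q (-ₚ q)) (trans (+-congˡ p (+-inverseʳ q)) (+-identityʳ p))

-- Reads off r - t·s = 1 with r a multiple of p and s a multiple of q; the hypothesis has the shape
-- of `geometric-suc`.
comaximal-intro : ∀ {p q r s} t → p ∣ r → q ∣ s → r ≋ 1ₚ +ₚ t *ₚ s → Comaximal p q
comaximal-intro {p} {q} {r} {s} t (divides a r≋pa) (divides b s≋qb) e = a , -ₚ (t *ₚ b) , (begin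
  a *ₚ p +ₚ (-ₚ (t *ₚ b)) *ₚ q             ≈⟨ +-cong (*-comm a p) (scale-* (ℚ.- 1ℚ) (t *ₚ b) q) ⟩
  p *ₚ a +ₚ (-ₚ ((t *ₚ b) *ₚ q))           ≈⟨ +-cong r≋pa (scale-cong (ℚ.- 1ℚ) (begin
    t *ₚ s            ≈⟨ *-congˡ t s≋qb ⟩
    t *ₚ (q *ₚ b)     ≈⟨ solve 3 (λ t q b → t :* (q :* b) := (t :* b) :* q) refl t q b ⟩
    (t *ₚ b) *ₚ q     ∎)) ⟨
  r +ₚ (-ₚ (t *ₚ s))                       ≈⟨ +-congʳ _ e ⟩
  (1ₚ +ₚ t *ₚ s) +ₚ (-ₚ (t *ₚ s))          ≈⟨ +-cancel-neg 1ₚ (t *ₚ s) ⟩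
  1ₚ                                       ∎)
  where open ≋-Reasoning

-- Geometric sums

nonZeroAt0-xPowMinusOne : ∀ n → .{{NonZero n}} → NonZeroAt0 (xPowMinusOne n)
nonZeroAt0-xPowMinusOne (suc n) ()

monomial≋1+xPowMinusOne : ∀ n → monomial n 1ℚ ≋ 1ₚ +ₚ xPowMinusOne n
monomial≋1+xPowMinusOne n = begin
  X                             ≈⟨ +-identityʳ X ⟨
  X +ₚ []                       ≈⟨ +-congˡ X (+-inverseʳ 1ₚ) ⟨
  X +ₚ (1ₚ +ₚ (-ₚ 1ₚ))          ≈⟨ solve 3 (λ x o m → x :+ (o :+ m) := o :+ (x :+ m)) refl X 1ₚ (-ₚ 1ₚ) ⟩
  1ₚ +ₚ (X +ₚ (-ₚ 1ₚ))          ∎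
  where
  open ≋-Reasoning
  X = monomial n 1ℚ

-- The polynomial (xⁿ - 1)/(x - 1) = 1 + x + ... + xⁿ⁻¹.
geometric : ℕ → Poly
geometric n = replicate n 1ℚ

∷-≋ : ∀ a p → a ∷ p ≋ (a ∷ []) +ₚ monomial 1 1ℚ *ₚ p
∷-≋ a p = sym (trans (+-congˡ (a ∷ []) (trans (0∷-* 1ₚ p) (∷-cong ≡.refl (*-identityˡ p))))
  (∷-cong (ℚ.+-identityʳ a) refl))

geometric-suc : ∀ n → geometric (suc n) ≋ 1ₚ +ₚ monomial 1 1ℚ *ₚ geometric n
geometric-suc n = ∷-≋ 1ℚ (geometric n)

*-distribˡ-1+ : ∀ p q → p *ₚ (1ₚ +ₚ q) ≋ p +ₚ p *ₚ q
*-distribˡ-1+ p q = trans (*-distribˡ-+ p 1ₚ q) (+-congʳ (p *ₚ q) (*-identityʳ p))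

-- With m = -1 this is the induction step for xⁿ - 1 = (x - 1)(1 + ... + xⁿ⁻¹). The identity holds
-- for every m, so the step involves no arithmetic with -1.
telescope : ∀ x m g → x *ₚ (1ₚ +ₚ (x +ₚ m) *ₚ g) +ₚ m ≋ (x +ₚ m) *ₚ (1ₚ +ₚ x *ₚ g)
telescope x m g = begin
  x *ₚ (1ₚ +ₚ (x +ₚ m) *ₚ g) +ₚ m               ≈⟨ +-congʳ m (*-distribˡ-1+ x ((x +ₚ m) *ₚ g)) ⟩
  (x +ₚ x *ₚ ((x +ₚ m) *ₚ g)) +ₚ m              ≈⟨ solve 3 (λ x m g → (x :+ x :* ((x :+ m) :* g)) :+ m := (x :+ m) :+ (x :+ m) :* (x :* g)) refl x m g ⟩
  (x +ₚ m) +ₚ (x +ₚ m) *ₚ (x *ₚ g)              ≈⟨ *-distribˡ-1+ (x +ₚ m) (x *ₚ g) ⟨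
  (x +ₚ m) *ₚ (1ₚ +ₚ x *ₚ g)                    ∎
  where open ≋-Reasoning

xPowMinusOne-geometric : ∀ n → xPowMinusOne n ≋ xPowMinusOne 1 *ₚ geometric n
xPowMinusOne-geometric zero    = sym (trans (*-zeroʳ (xPowMinusOne 1)) (sym 0∷[]))
xPowMinusOne-geometric (suc n) = begin
  monomial (suc n) 1ℚ +ₚ m                      ≈⟨ +-congʳ m (monomial-* 1 n 1ℚ) ⟨
  X *ₚ monomial n 1ℚ +ₚ m                       ≈⟨ +-congʳ m (*-congˡ X (monomial≋1+xPowMinusOne n)) ⟩
  X *ₚ (1ₚ +ₚ xPowMinusOne n) +ₚ m              ≈⟨ +-congʳ m (*-congˡ X (+-congˡ 1ₚ (xPowMinusOne-geometric n))) ⟩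
  X *ₚ (1ₚ +ₚ (X +ₚ m) *ₚ geometric n) +ₚ m     ≈⟨ telescope X m (geometric n) ⟩
  (X +ₚ m) *ₚ (1ₚ +ₚ X *ₚ geometric n)          ≈⟨ *-congˡ (X +ₚ m) (geometric-suc n) ⟨
  (X +ₚ m) *ₚ geometric (suc n)                 ∎
  where
  open ≋-Reasoning
  X = monomial 1 1ℚ
  m = ℚ.- 1ℚ ∷ []

xPowMinusOne-∣ : ∀ m v → xPowMinusOne m ∣ xPowMinusOne (m ℕ.* v)
xPowMinusOne-∣ m v = ∣-resp
  (trans (expand-xPowMinusOne m 1) (reflexive (cong xPowMinusOne (ℕ.*-identityʳ m))))
  (expand-xPowMinusOne m v)
  (expand-∣ m {xPowMinusOne 1} (divides (geometric v) (xPowMinusOne-geometric v)))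

geometric-∣ : ∀ u v → geometric u ∣ geometric (u ℕ.* v)
geometric-∣ u v = divides (expand u (geometric v))
  (*-cancelˡ (xPowMinusOne 1) (nonZeroAt0-xPowMinusOne 1) (begin
    P *ₚ geometric (u ℕ.* v)                     ≈⟨ xPowMinusOne-geometric (u ℕ.* v) ⟨
    xPowMinusOne (u ℕ.* v)                       ≈⟨ expand-xPowMinusOne u v ⟨
    expand u (xPowMinusOne v)                    ≈⟨ expand-cong u (xPowMinusOne-geometric v) ⟩
    expand u (P *ₚ geometric v)                  ≈⟨ expand-* u P (geometric v) ⟩
    expand u P *ₚ expand u (geometric v)         ≈⟨ *-congʳ _ (expand-xPowMinusOne u 1) ⟩
    xPowMinusOne (u ℕ.* 1) *ₚ expand u (geometric v)   ≡⟨ cong (λ k → xPowMinusOne k *ₚ expand u (geometric v)) (ℕ.*-identityʳ u) ⟩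
    xPowMinusOne u *ₚ expand u (geometric v)     ≈⟨ *-congʳ _ (xPowMinusOne-geometric u) ⟩
    (P *ₚ geometric u) *ₚ expand u (geometric v) ≈⟨ *-assoc P (geometric u) _ ⟩
    P *ₚ (geometric u *ₚ expand u (geometric v)) ∎))
  where
  open ≋-Reasoning
  P = xPowMinusOne 1

-- Write G for `geometric` and X for the variable. Since u·x = 1 + v·y, G(u·x) = 1 + X·G(v·y), where
-- G(u) divides the left side and G(v) divides G(v·y).
geometric-bézout : ∀ u v x y → 1 ℕ.+ y ℕ.* v ≡ x ℕ.* u → Comaximal (geometric u) (geometric v)
geometric-bézout u v x y eq = comaximal-intro (monomial 1 1ℚ) (geometric-∣ u x) (geometric-∣ v y)
  (trans (reflexive (cong geometric ux≡1+vy)) (geometric-suc (v ℕ.* y)))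
  where
  ux≡1+vy : u ℕ.* x ≡ suc (v ℕ.* y)
  ux≡1+vy = ≡.trans (ℕ.*-comm u x) (≡.trans (≡.sym eq) (cong suc (ℕ.*-comm y v)))

geometric-comaximal : ∀ {u v} → Coprime u v → Comaximal (geometric u) (geometric v)
geometric-comaximal {u} {v} c with Coprime.coprime-Bézout c
... | Bézout.+- x y eq = geometric-bézout u v x y eq
... | Bézout.-+ x y eq = comaximal-sym (geometric-bézout v u y x eq)

-- Products and sums over lists

module ListFold (M : CommutativeMonoid 0ℓ 0ℓ) where
  private module M = CommutativeMonoid M
  open M using (Carrier; _≈_; _∙_; ε)

  -- Shaped so that its instances agree definitionally with the products in `IsCyclotomic` and the
  -- sum in `necklace`.
  fold : {A : Set} → (A → Carrier) → List A → Carrier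
  fold f xs = foldr _∙_ ε (map f xs)

  fold-↭ : ∀ {A : Set} (f : A → Carrier) {xs ys} → xs ↭ ys → fold f xs ≈ fold f ys
  fold-↭ f ↭.refl         = M.refl
  fold-↭ f (↭.prep x r)   = M.∙-congˡ (fold-↭ f r)
  fold-↭ f (↭.swap x y r) = M.trans (M.sym (M.assoc _ _ _))
    (M.trans (M.∙-cong (M.comm (f x) (f y)) (fold-↭ f r)) (M.assoc _ _ _))
  fold-↭ f (↭.trans r s)  = M.trans (fold-↭ f r) (fold-↭ f s)

  fold-++ : ∀ {A : Set} (f : A → Carrier) xs ys → fold f (xs ++ ys) ≈ fold f xs ∙ fold f ys
  fold-++ f []       ys = M.sym (M.identityˡ _)
  fold-++ f (x ∷ xs) ys = M.trans (M.∙-congˡ (fold-++ f xs ys)) (M.sym (M.assoc _ _ _))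

  fold-filter : ∀ {A : Set} {P : A → Set} (P? : Decidable P) (f : A → Carrier) →
    (∀ {x} → ¬ P x → f x ≈ ε) → ∀ xs → fold f xs ≈ fold f (filter P? xs)
  fold-filter P? f f≈ε []       = M.refl
  fold-filter P? f f≈ε (x ∷ xs) with P? x
  ... | yes _  = M.∙-congˡ (fold-filter P? f f≈ε xs)
  ... | no ¬Px = M.trans (M.∙-cong (f≈ε ¬Px) (fold-filter P? f f≈ε xs)) (M.identityˡ _)

open ListFold (CommutativeRing.*-commutativeMonoid polyRing) using ()
  renaming (fold to ∏; fold-↭ to ∏-↭; fold-++ to ∏-++)
open ListFold (CommutativeRing.+-commutativeMonoid polyRing) using ()
  renaming (fold to ∑; fold-↭ to ∑-↭; fold-filter to ∑-filter)

-- Cyclotomic polynomials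

expand-∏ : ∀ k es → ∏ xPowMinusOne (map (k ℕ.*_) es) ≋ expand k (∏ xPowMinusOne es)
expand-∏ k []       = sym (expand-const k 1ℚ)
expand-∏ k (e ∷ es) = begin
  xPowMinusOne (k ℕ.* e) *ₚ ∏ xPowMinusOne (map (k ℕ.*_) es)   ≈⟨ *-cong (sym (expand-xPowMinusOne k e)) (expand-∏ k es) ⟩
  expand k (xPowMinusOne e) *ₚ expand k (∏ xPowMinusOne es)    ≈⟨ expand-* k (xPowMinusOne e) (∏ xPowMinusOne es) ⟨
  expand k (xPowMinusOne e *ₚ ∏ xPowMinusOne es)               ∎
  where open ≋-Reasoning

nonZeroAt0-∏ : ∀ es → (∀ {e} → e ∈ es → NonZero e) → NonZeroAt0 (∏ xPowMinusOne es)
nonZeroAt0-∏ []       _  ()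
nonZeroAt0-∏ (e ∷ es) nz = nonZeroAt0-* (xPowMinusOne e) (∏ xPowMinusOne es)
  (nonZeroAt0-xPowMinusOne e {{nz (here ≡.refl)}}) (nonZeroAt0-∏ es (nz ∘ there))

cycProduct : ℤ → ℕ → Poly
cycProduct s n = ∏ xPowMinusOne (exponents s n)

numerator denominator : ℕ → Poly
numerator   = cycProduct (+ 1)
denominator = cycProduct ℤ.-[1+ 0 ]

nonZeroAt0-cycProduct : ∀ s n → NonZeroAt0 (cycProduct s n)
nonZeroAt0-cycProduct s n = nonZeroAt0-∏ (exponents s n) λ e∈ →
  proj₁ (∈-divisors⁻ {n = n} (proj₁ (∈-filter⁻ (λ e → μ (divN n e) ℤ.≟ s) {xs = divisors n} e∈)))

module _ {p n : ℕ} (pr : Prime p) .{{_ : NonZero n}} where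

  cycProduct-∣ : ∀ {s} → s ≢ + 0 → p ℕ.∣ n → cycProduct s (p ℕ.* n) ≋ expand p (cycProduct s n)
  cycProduct-∣ {s} s≢0 p∣n = trans (∏-↭ xPowMinusOne (exponents-∣ pr s≢0 p∣n)) (expand-∏ p (exponents s n))

  cycProduct-∤ : ∀ s → ¬ p ℕ.∣ n →
    cycProduct s (p ℕ.* n) ≋ expand p (cycProduct s n) *ₚ cycProduct (ℤ.- s) n
  cycProduct-∤ s p∤n = begin
    cycProduct s (p ℕ.* n)
      ≈⟨ ∏-↭ xPowMinusOne (exponents-∤ pr p∤n) ⟩
    ∏ xPowMinusOne (map (p ℕ.*_) (exponents s n) ++ exponents (ℤ.- s) n)
      ≈⟨ ∏-++ xPowMinusOne (map (p ℕ.*_) (exponents s n)) (exponents (ℤ.- s) n) ⟩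
    ∏ xPowMinusOne (map (p ℕ.*_) (exponents s n)) *ₚ cycProduct (ℤ.- s) n
      ≈⟨ *-congʳ _ (expand-∏ p (exponents s n)) ⟩
    expand p (cycProduct s n) *ₚ cycProduct (ℤ.- s) n ∎
    where open ≋-Reasoning

record Cyclotomic (n : ℕ) (P : Poly) : Set where
  constructor cyclotomic
  field productFormula : P *ₚ denominator n ≋ numerator n

-- The denominator has nonzero constant term and cancels. This transfers what is known of the
-- constructed Φₙ to an arbitrary polynomial satisfying the product formula.
cyclotomic-unique : ∀ {n P Q} → Cyclotomic n P → Cyclotomic n Q → P ≋ Q
cyclotomic-unique {n} (cyclotomic e) (cyclotomic f) =
  *-cancelʳ (denominator n) (nonZeroAt0-cycProduct ℤ.-[1+ 0 ] n) (trans e (sym f))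

module _ {p n P} (pr : Prime p) .{{_ : NonZero n}} (cyc : Cyclotomic n P) where
  open Cyclotomic cyc
  private
    N = numerator n
    D = denominator n
    expanded : expand p P *ₚ expand p D ≋ expand p N
    expanded = trans (sym (expand-* p P D)) (expand-cong p productFormula)

  cyclotomic-∣ : p ℕ.∣ n → Cyclotomic (p ℕ.* n) (expand p P)
  cyclotomic-∣ p∣n = cyclotomic (begin
    expand p P *ₚ denominator (p ℕ.* n)  ≈⟨ *-congˡ (expand p P) (cycProduct-∣ pr (λ ()) p∣n) ⟩
    expand p P *ₚ expand p D             ≈⟨ expanded ⟩
    expand p N                           ≈⟨ cycProduct-∣ pr (λ ()) p∣n ⟨
    numerator (p ℕ.* n)                  ∎)
    where open ≋-Reasoning

  -- Passing from n to p·n substitutes xᵖ and multiplies the numerator by the old denominator and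
  -- the denominator by the old numerator, which amounts to dividing by Φₙ(x).
  cyclotomic-∤ : ∀ {Q} → ¬ p ℕ.∣ n → expand p P ≋ P *ₚ Q → Cyclotomic (p ℕ.* n) Q
  cyclotomic-∤ {Q} p∤n e = cyclotomic (begin
    Q *ₚ denominator (p ℕ.* n)           ≈⟨ *-congˡ Q (cycProduct-∤ pr ℤ.-[1+ 0 ] p∤n) ⟩
    Q *ₚ (expand p D *ₚ N)               ≈⟨ *-congˡ Q (*-congˡ (expand p D) productFormula) ⟨
    Q *ₚ (expand p D *ₚ (P *ₚ D))        ≈⟨ solve 4 (λ q e p d → q :* (e :* (p :* d)) := ((p :* q) :* e) :* d) refl Q (expand p D) P D ⟩
    ((P *ₚ Q) *ₚ expand p D) *ₚ D        ≈⟨ *-congʳ D (*-congʳ (expand p D) e) ⟨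
    (expand p P *ₚ expand p D) *ₚ D      ≈⟨ *-congʳ D expanded ⟩
    expand p N *ₚ D                      ≈⟨ cycProduct-∤ pr (+ 1) p∤n ⟨
    numerator (p ℕ.* n)                  ∎)
    where open ≋-Reasoning

-- The strengthened induction hypothesis: `∣expand` at p·n needs `comaximal` at n. There Q and R are
-- any quotients Φₙ(xᵘ)/Φₙ(x) and Φₙ(xᵛ)/Φₙ(x), so the field does not depend on the cofactors chosen
-- by `∣expand`.
record Φ (n : ℕ) : Set where
  field
    poly          : Poly
    isCyclotomic  : Cyclotomic n poly
    ∣xPowMinusOne : poly ∣ xPowMinusOne n
    ∣expand       : ∀ u → Coprime u n → poly ∣ expand u poly
    comaximal     : ∀ {u v Q R} → Coprime u n → Coprime v n → Coprime u v →
      expand u poly ≋ poly *ₚ Q → expand v poly ≋ poly *ₚ R → Comaximal Q R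

  nonZeroAt0 : .{{NonZero n}} → NonZeroAt0 poly
  nonZeroAt0 = nonZeroAt0-∣ ∣xPowMinusOne (nonZeroAt0-xPowMinusOne n)

-- For n = 1 the quotient (xᵘ - 1)/(x - 1) is a geometric sum, and comaximality comes from Bézout
-- for u and v.
Φ₁ : Φ 1
Φ₁ = record
  { poly          = x-1
  ; isCyclotomic  = cyclotomic (trans (*-identityʳ x-1) (sym (*-identityʳ x-1)))
  ; ∣xPowMinusOne = divides 1ₚ (sym (*-identityʳ x-1))
  ; ∣expand       = λ u _ → divides (geometric u) (expanded u)
  ; comaximal     = λ {u} {v} _ _ u⊥v e f → comaximal-cong (quotient u e) (quotient v f) (geometric-comaximal u⊥v)
  }
  where
  x-1 = xPowMinusOne 1
  expanded : ∀ u → expand u x-1 ≋ x-1 *ₚ geometric u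
  expanded u = trans (expand-xPowMinusOne u 1)
    (trans (reflexive (cong xPowMinusOne (ℕ.*-identityʳ u))) (xPowMinusOne-geometric u))
  quotient : ∀ u {Q} → expand u x-1 ≋ x-1 *ₚ Q → geometric u ≋ Q
  quotient u e = *-cancelˡ x-1 (nonZeroAt0-xPowMinusOne 1) (trans (sym (expanded u)) e)

module _ {p n : ℕ} (pr : Prime p) .{{_ : NonZero n}} (Φₙ : Φ n) where
  open Φ Φₙ
  private
    instance
      p-nonZero : NonZero p
      p-nonZero = prime⇒nonZero pr
    coprime-factor : ∀ {u} → Coprime u (p ℕ.* n) → Coprime u n
    coprime-factor c (i∣u , i∣n) = c (i∣u , ℕ.∣n⇒∣m*n p i∣n)
    coprime-p : ∀ {u} → Coprime u (p ℕ.* n) → Coprime u p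
    coprime-p c (i∣u , i∣p) = c (i∣u , ℕ.∣m⇒∣m*n n i∣p)
    ∣xᵖⁿ-1 : expand p poly ∣ xPowMinusOne (p ℕ.* n)
    ∣xᵖⁿ-1 = ∣-resp refl (expand-xPowMinusOne p n) (expand-∣ p ∣xPowMinusOne)

  -- The substitutions x ↦ xᵖ and x ↦ xᵘ commute, so all the data, quotients included, are those for
  -- n evaluated at xᵖ.
  Φ-∣ : p ℕ.∣ n → Φ (p ℕ.* n)
  Φ-∣ p∣n = record
    { poly          = expand p poly
    ; isCyclotomic  = cyclotomic-∣ pr isCyclotomic p∣n
    ; ∣xPowMinusOne = ∣xᵖⁿ-1
    ; ∣expand       = λ u c → ∣-resp refl (expand-expand-comm p u poly) (expand-∣ p (∣expand u (coprime-factor c)))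
    ; comaximal     = λ {u} {v} cu cv u⊥v e f →
        let divides Q₀ e₀ = ∣expand u (coprime-factor cu)
            divides R₀ f₀ = ∣expand v (coprime-factor cv)
        in comaximal-cong (quotient u e₀ e) (quotient v f₀ f)
             (comaximal-expand p (comaximal (coprime-factor cu) (coprime-factor cv) u⊥v e₀ f₀))
    }
    where
    quotient : ∀ u {Q₀ Q} → expand u poly ≋ poly *ₚ Q₀ →
      expand u (expand p poly) ≋ expand p poly *ₚ Q → expand p Q₀ ≋ Q
    quotient u {Q₀} {Q} e₀ e = *-cancelˡ (expand p poly) (nonZeroAt0-expand p {poly} nonZeroAt0) (begin
      expand p poly *ₚ expand p Q₀   ≈⟨ expand-* p poly Q₀ ⟨
      expand p (poly *ₚ Q₀)          ≈⟨ expand-cong p e₀ ⟨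
      expand p (expand u poly)       ≈⟨ expand-expand-comm p u poly ⟩
      expand u (expand p poly)       ≈⟨ e ⟩
      expand p poly *ₚ Q             ∎)
      where open ≋-Reasoning

  module _ (p∤n : ¬ p ℕ.∣ n) where
    private
      p⊥n : Coprime p n
      p⊥n = prime∤⇒coprime pr p∤n
      -- `P′` is Φₙ(xᵖ)/Φₙ(x), the future Φₚₙ; it is `∣expand` at u = p that makes the quotient a
      -- polynomial.
      open _∣_ (∣expand p p⊥n) renaming (cofactor to P′; isCofactor to expand-p)

      P′∣expand-p : P′ ∣ expand p poly
      P′∣expand-p = divides poly (trans expand-p (*-comm poly P′))

      nonZeroAt0-P′ : NonZeroAt0 P′
      nonZeroAt0-P′ = nonZeroAt0-∣ P′∣expand-p (nonZeroAt0-expand p {poly} nonZeroAt0)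

      -- After multiplication by Φₙ(x), both sides equal Φₙ(xᵘᵖ), expanded in the two possible
      -- orders.
      exchange : ∀ u {Q} → expand u poly ≋ poly *ₚ Q → expand u P′ *ₚ Q ≋ P′ *ₚ expand p Q
      exchange u {Q} e = *-cancelˡ poly nonZeroAt0 (begin
        poly *ₚ (expand u P′ *ₚ Q)          ≈⟨ solve 3 (λ a b c → a :* (b :* c) := (a :* c) :* b) refl poly (expand u P′) Q ⟩
        (poly *ₚ Q) *ₚ expand u P′          ≈⟨ *-congʳ (expand u P′) e ⟨
        expand u poly *ₚ expand u P′        ≈⟨ expand-* u poly P′ ⟨
        expand u (poly *ₚ P′)               ≈⟨ expand-cong u expand-p ⟨
        expand u (expand p poly)            ≈⟨ expand-expand-comm u p poly ⟩
        expand p (expand u poly)            ≈⟨ expand-cong p e ⟩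
        expand p (poly *ₚ Q)                ≈⟨ expand-* p poly Q ⟩
        expand p poly *ₚ expand p Q         ≈⟨ *-congʳ (expand p Q) expand-p ⟩
        (poly *ₚ P′) *ₚ expand p Q          ≈⟨ *-assoc poly P′ (expand p Q) ⟩
        poly *ₚ (P′ *ₚ expand p Q)          ∎)
        where open ≋-Reasoning

      -- By `exchange`, the quotient for p·n is Q(xᵖ)/Q(x). As a factor of Q(xᵖ), it inherits
      -- comaximality from the substituted quotients for n.
      quotient-∣ : ∀ u {Q Q′} → expand u poly ≋ poly *ₚ Q → expand u P′ ≋ P′ *ₚ Q′ → Q′ ∣ expand p Q
      quotient-∣ u {Q} {Q′} e e′ = divides Q (*-cancelˡ P′ nonZeroAt0-P′ (begin
        P′ *ₚ expand p Q      ≈⟨ exchange u e ⟨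
        expand u P′ *ₚ Q      ≈⟨ *-congʳ Q e′ ⟩
        (P′ *ₚ Q′) *ₚ Q       ≈⟨ *-assoc P′ Q′ Q ⟩
        P′ *ₚ (Q′ *ₚ Q)       ∎))
        where open ≋-Reasoning

    Φ-∤ : Φ (p ℕ.* n)
    Φ-∤ = record
      { poly          = P′
      ; isCyclotomic  = cyclotomic-∤ pr isCyclotomic p∤n expand-p
      ; ∣xPowMinusOne = ∣-trans P′∣expand-p ∣xᵖⁿ-1
      ; ∣expand       = λ u c →
          let divides Q e = ∣expand u (coprime-factor c)
          in comaximal-∣ (comaximal p⊥n (coprime-factor c) (Coprime.sym (coprime-p c)) expand-p e)
               (divides (expand p Q) (exchange u e))
      ; comaximal     = λ {u} {v} cu cv u⊥v e′ f′ →
          let divides Q e = ∣expand u (coprime-factor cu)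
              divides R f = ∣expand v (coprime-factor cv)
          in comaximal-factor (quotient-∣ u e e′) (quotient-∣ v f f′)
               (comaximal-expand p (comaximal (coprime-factor cu) (coprime-factor cv) u⊥v e f))
      }

Φ-exists : ∀ n → .{{NonZero n}} → Φ n
Φ-exists = prime-induction Φ Φ₁ step
  where
  step : ∀ p n → Prime p → .{{NonZero n}} → Φ n → Φ (p ℕ.* n)
  step p n pr Φₙ with p ℕ.∣? n
  ... | yes p∣n = Φ-∣ pr Φₙ p∣n
  ... | no  p∤n = Φ-∤ pr Φₙ p∤n

-- Descent along x ↦ xᵏ

-- Modulo xᵐ - 1 the power x¹⁺ᵐᵛ is congruent to x, so substituting it changes f only by a multiple
-- of xᵐ - 1.
expand-1+ : ∀ m v f → ∃ λ r → expand (1 ℕ.+ m ℕ.* v) f ≋ f +ₚ xPowMinusOne m *ₚ r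
expand-1+ m v []      = [] , sym (*-zeroʳ (xPowMinusOne m))
expand-1+ m v (a ∷ f) with expand-1+ m v f | xPowMinusOne-∣ m v
... | r , e | divides t xᵐᵛ = X *ₚ (r +ₚ t *ₚ E) , (begin
  A +ₚ monomial (1 ℕ.+ m ℕ.* v) 1ℚ *ₚ E       ≈⟨ +-congˡ A (*-congʳ E (monomial-* 1 (m ℕ.* v) 1ℚ)) ⟨
  A +ₚ (X *ₚ monomial (m ℕ.* v) 1ℚ) *ₚ E      ≈⟨ +-congˡ A (*-congʳ E (*-congˡ X (trans (monomial≋1+xPowMinusOne (m ℕ.* v)) (+-congˡ 1ₚ xᵐᵛ)))) ⟩
  A +ₚ (X *ₚ (1ₚ +ₚ M *ₚ t)) *ₚ E             ≈⟨ rearrange A X M t E f r e ⟩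
  (A +ₚ X *ₚ f) +ₚ M *ₚ (X *ₚ (r +ₚ t *ₚ E))  ≈⟨ +-congʳ _ (∷-≋ a f) ⟨
  (a ∷ f) +ₚ M *ₚ (X *ₚ (r +ₚ t *ₚ E))        ∎)
  where
  open ≋-Reasoning
  A = a ∷ []
  X = monomial 1 1ℚ
  M = xPowMinusOne m
  E = expand (1 ℕ.+ m ℕ.* v) f
  rearrange : ∀ A X M t E f r → E ≋ f +ₚ M *ₚ r →
    A +ₚ (X *ₚ (1ₚ +ₚ M *ₚ t)) *ₚ E ≋ (A +ₚ X *ₚ f) +ₚ M *ₚ (X *ₚ (r +ₚ t *ₚ E))
  rearrange A X M t E f r e = begin
    A +ₚ (X *ₚ (1ₚ +ₚ M *ₚ t)) *ₚ E                      ≈⟨ +-congˡ A (*-congʳ E (*-distribˡ-1+ X (M *ₚ t))) ⟩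
    A +ₚ (X +ₚ X *ₚ (M *ₚ t)) *ₚ E                       ≈⟨ solve 5 (λ A X M t E → A :+ (X :+ X :* (M :* t)) :* E := A :+ (X :* E :+ X :* (M :* t) :* E)) refl A X M t E ⟩
    A +ₚ (X *ₚ E +ₚ X *ₚ (M *ₚ t) *ₚ E)                  ≈⟨ +-congˡ A (+-congʳ _ (*-congˡ X e)) ⟩
    A +ₚ (X *ₚ (f +ₚ M *ₚ r) +ₚ X *ₚ (M *ₚ t) *ₚ E)      ≈⟨ solve 7 (λ A X M t E f r → A :+ (X :* (f :+ M :* r) :+ X :* (M :* t) :* E) := (A :+ X :* f) :+ M :* (X :* (r :+ t :* E))) refl A X M t E f r ⟩
    (A +ₚ X *ₚ f) +ₚ M *ₚ (X *ₚ (r +ₚ t *ₚ E))           ∎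

-- Φₙ is the cyclotomic polynomial whose roots are the k-th powers of the roots of P.
record Descent (k : ℕ) (P : Poly) : Set where
  field
    n            : ℕ
    n-nonZero    : NonZero n
    Φₙ           : Poly
    isCyclotomic : Cyclotomic n Φₙ
    descend      : ∀ f → P ∣ expand k f → Φₙ ∣ f
    lift         : P ∣ expand k Φₙ

descent-resp : ∀ {k P Q} → P ≋ Q → Descent k P → Descent k Q
descent-resp P≋Q δ = record
  { n = n ; n-nonZero = n-nonZero ; Φₙ = Φₙ ; isCyclotomic = isCyclotomic
  ; descend = λ f → descend f ∘ ∣-resp (sym P≋Q) refl
  ; lift = ∣-resp P≋Q refl lift }
  where open Descent δ

module _ {p : ℕ} (pr : Prime p) where
  private
    instance
      p-nonZero : NonZero p
      p-nonZero = prime⇒nonZero pr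

  -- For p ∤ m the p-th power map permutes the primitive m-th roots of unity, so the descended index
  -- is m itself.
  descent-coprime : ∀ {m} → .{{NonZero m}} → ¬ p ℕ.∣ m → (Φₘ : Φ m) → Descent p (Φ.poly Φₘ)
  descent-coprime {m} p∤m Φₘ = record
    { n            = m
    ; n-nonZero    = ℕ.≢-nonZero (ℕ.≢-nonZero⁻¹ m)
    ; Φₙ           = P
    ; isCyclotomic = isCyclotomic
    ; descend      = descend
    ; lift         = ∣expand p p⊥m
    }
    where
    open Φ Φₘ renaming (poly to P)
    p⊥m : Coprime p m
    p⊥m = prime∤⇒coprime pr p∤m
    -- If up ≡ 1 mod m then xᵘᵖ ≡ x mod Φₘ, so x ↦ xᵘ inverts x ↦ xᵖ.
    descend : ∀ f → P ∣ expand p f → P ∣ f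
    descend f P∣ = case inverse-mod p m p⊥m of λ where
      (u , v , up≡1+mv) → case expand-1+ m v f of λ where
        -- f is f(xᵘᵖ) minus a multiple of xᵐ - 1. The first is divisible by Φₘ because Φₘ(x) ∣
        -- Φₘ(xᵘ) ∣ f(xᵘᵖ), the second because Φₘ ∣ xᵐ - 1.
        (r , e) → ∣-resp refl (trans (+-congʳ _ e) (+-cancel-neg f (xPowMinusOne m *ₚ r)))
          (∣-+ (∣-resp refl (trans (expand-expand u p f) (reflexive (cong (λ k → expand k f) up≡1+mv)))
                 (∣-trans (∣expand u (inverse-coprime up≡1+mv)) (expand-∣ u P∣)))
               (∣-scale (ℚ.- 1ℚ) (∣-trans ∣xPowMinusOne (divides r refl))))

  module _ {n : ℕ} .{{_ : NonZero n}} (Φₙ : Φ n) where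
    open Φ Φₙ renaming (poly to P)

    -- Here the divisor is already a polynomial in xᵖ, so the multiplier 1 suffices in
    -- `expand-reflects-∣`.
    descent-∣ : Descent p (expand p P)
    descent-∣ = record
      { n            = n
      ; n-nonZero    = ℕ.≢-nonZero (ℕ.≢-nonZero⁻¹ n)
      ; Φₙ           = P
      ; isCyclotomic = isCyclotomic
      ; descend      = λ f P∣ → expand-reflects-∣ p 1ℚ (section-const p 1ℚ) (λ ())
                         (∣-resp refl (sym (*-identityʳ (expand p f))) P∣)
      ; lift         = divides 1ₚ (sym (*-identityʳ (expand p P)))
      }

    -- Φₙ(xᵖ) = Φₙ(x) Q(x) divides f(xᵖ) (xⁿ − 1), and −1 is the only coefficient of xⁿ − 1 at a multiple of p.
    descent-∤ : ¬ p ℕ.∣ n → ∀ {Q} → expand p P ≋ P *ₚ Q → Descent p Q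
    descent-∤ p∤n {Q} e = record
      { n            = n
      ; n-nonZero    = ℕ.≢-nonZero (ℕ.≢-nonZero⁻¹ n)
      ; Φₙ           = P
      ; isCyclotomic = isCyclotomic
      ; descend      = λ f Q∣ → expand-reflects-∣ p (ℚ.- 1ℚ) (section-xPowMinusOne p n p∤n) (λ ())
                         (∣-resp (trans (*-comm Q P) (sym e)) refl (∣-* Q∣ ∣xPowMinusOne))
      ; lift         = divides P (trans e (*-comm P Q))
      }

  prime-descent : ∀ {m P} → .{{NonZero m}} → Cyclotomic m P → Descent p P
  prime-descent {m} cyc with p ℕ.∣? m
  ... | no  p∤m = descent-resp (cyclotomic-unique (Φ.isCyclotomic Φₘ) cyc) (descent-coprime p∤m Φₘ)
    where Φₘ = Φ-exists m
  -- The rewrite puts m in the form p·n in which the Φ are built; whether p ∣ n then decides between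
  -- Φₙ(xᵖ) and its quotient by Φₙ(x).
  ... | yes (ℕ.divides n ≡.refl) rewrite ℕ.*-comm n p with p ℕ.∣? n
  ...   | yes p∣n = descent-resp (cyclotomic-unique (cyclotomic-∣ pr (Φ.isCyclotomic Φₙ) p∣n) cyc) (descent-∣ Φₙ)
    where
    instance
      n-nonZero : NonZero n
      n-nonZero = ℕ.m*n≢0⇒n≢0 p
    Φₙ = Φ-exists n
  ...   | no p∤n = descent-resp (cyclotomic-unique (cyclotomic-∤ pr (Φ.isCyclotomic Φₙ) p∤n expanded) cyc) (descent-∤ Φₙ p∤n expanded)
    where
    instance
      n-nonZero : NonZero n
      n-nonZero = ℕ.m*n≢0⇒n≢0 p
    Φₙ = Φ-exists n
    expanded = _∣_.isCofactor (Φ.∣expand Φₙ p (prime∤⇒coprime pr p∤n))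

-- The induction on k keeps m and P general, because the hypothesis for the remaining k is applied
-- to the cyclotomic polynomial produced by the first prime. The descents then compose.
descent : ∀ k → .{{NonZero k}} → ∀ {m P} → .{{NonZero m}} → Cyclotomic m P → Descent k P
descent = prime-induction _ base step
  where
  base : ∀ {m P} → .{{NonZero m}} → Cyclotomic m P → Descent 1 P
  base {m} {P} cyc = record
    { n            = m
    ; n-nonZero    = ℕ.≢-nonZero (ℕ.≢-nonZero⁻¹ m)
    ; Φₙ           = P
    ; isCyclotomic = cyc
    ; descend      = λ f → ∣-resp refl (expand-1 f)
    ; lift         = divides 1ₚ (trans (expand-1 P) (sym (*-identityʳ P)))
    }
  step : ∀ p k → Prime p → .{{NonZero k}} →
    (∀ {m P} → .{{NonZero m}} → Cyclotomic m P → Descent k P) →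
    ∀ {m P} → .{{NonZero m}} → Cyclotomic m P → Descent (p ℕ.* k) P
  step p k pr ih cyc = record
    { n            = δ₂.n
    ; n-nonZero    = δ₂.n-nonZero
    ; Φₙ           = δ₂.Φₙ
    ; isCyclotomic = δ₂.isCyclotomic
    ; descend      = λ f → δ₂.descend f ∘ δ₁.descend (expand k f) ∘ ∣-resp refl (sym (expand-expand p k f))
    ; lift         = ∣-resp refl (expand-expand p k δ₂.Φₙ) (∣-trans δ₁.lift (expand-∣ p δ₂.lift))
    }
    where
    module δ₁ = Descent (prime-descent pr cyc)
    module δ₂ = Descent (ih {{δ₁.n-nonZero}} δ₁.isCyclotomic)

-- Necklace polynomials

necklaceTerm : ℕ → ℕ → Poly
necklaceTerm d e = monomial (divN d e) (μ e ℚ./ 1)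

monomial-0 : ∀ k → monomial k 0ℚ ≋ []
monomial-0 zero    = 0∷[]
monomial-0 (suc k) = trans (∷-cong ≡.refl (monomial-0 k)) 0∷[]

necklaceTerm-0 : ∀ d {e} → ¬ (μ e ≢ + 0) → necklaceTerm d e ≋ []
necklaceTerm-0 d {e} ¬μ≢0 = trans
  (reflexive (cong (λ z → monomial (divN d e) (z ℚ./ 1)) (decidable-stable (μ e ℤ.≟ + 0) ¬μ≢0)))
  (monomial-0 (divN d e))

∑-squarefree : ∀ d n → ∑ (necklaceTerm d) (divisors n) ≋ ∑ (necklaceTerm d) (squarefreeDivisors n)
∑-squarefree d n = ∑-filter (λ e → ¬? (μ e ℤ.≟ + 0)) (necklaceTerm d) (λ {e} → necklaceTerm-0 d {e}) (divisors n)

-- For e ∣ c the exponent (k·c)/e equals k·(c/e), so each term is its counterpart for c evaluated at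
-- xᵏ.
∑-expand : ∀ k c es → (∀ {e} → e ∈ es → NonZero e × e ℕ.∣ c) →
  ∑ (necklaceTerm (k ℕ.* c)) es ≋ expand k (∑ (necklaceTerm c) es)
∑-expand k c []       _    = refl
∑-expand k c (e ∷ es) es∣c = begin
  necklaceTerm (k ℕ.* c) e +ₚ ∑ (necklaceTerm (k ℕ.* c)) es
    ≈⟨ +-cong (term (es∣c (here ≡.refl))) (∑-expand k c es (es∣c ∘ there)) ⟩
  expand k (necklaceTerm c e) +ₚ expand k (∑ (necklaceTerm c) es)
    ≈⟨ expand-+ k (necklaceTerm c e) (∑ (necklaceTerm c) es) ⟨
  expand k (necklaceTerm c e +ₚ ∑ (necklaceTerm c) es) ∎
  where
  open ≋-Reasoning
  term : NonZero e × e ℕ.∣ c → necklaceTerm (k ℕ.* c) e ≋ expand k (necklaceTerm c e)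
  term (e-nonZero , ℕ.divides q ≡.refl) = begin
    monomial (divN (k ℕ.* (q ℕ.* e)) e) a   ≡⟨ cong (λ t → monomial (divN t e) a) (ℕ.*-assoc k q e) ⟨
    monomial (divN (k ℕ.* q ℕ.* e) e) a     ≡⟨ cong (λ t → monomial t a) (divN-* (k ℕ.* q) e {{e-nonZero}}) ⟩
    monomial (k ℕ.* q) a                    ≈⟨ expand-monomial k q a ⟨
    expand k (monomial q a)                 ≡⟨ cong (λ t → expand k (monomial t a)) (divN-* q e {{e-nonZero}}) ⟨
    expand k (monomial (divN (q ℕ.* e) e) a) ∎
    where a = μ e ℚ./ 1

invN-nonZero : ∀ d → .{{NonZero d}} → ℚ.NonZero (invN d)
invN-nonZero (suc d) = ℚ.pos⇒nonZero (invN (suc d)) {{ℚ.normalize-pos 1 (suc d)}}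

module _ (d : ℕ) .{{_ : NonZero d}} (k : ℕ) (d≡k*rad : d ≡ k ℕ.* rad d) where
  private
    c = rad d
    S = ∑ (necklaceTerm d) (divisors d)

  necklaceSum-rad : S ≋ expand k (∑ (necklaceTerm c) (divisors c))
  necklaceSum-rad = begin
    ∑ (necklaceTerm d) (divisors d)                         ≈⟨ ∑-squarefree d d ⟩
    ∑ (necklaceTerm d) (squarefreeDivisors d)               ≈⟨ ∑-↭ (necklaceTerm d) (squarefreeDivisors-rad d) ⟩
    ∑ (necklaceTerm d) (squarefreeDivisors c)               ≈⟨ ∑-squarefree d c ⟨
    ∑ (necklaceTerm d) (divisors c)                         ≡⟨ cong (λ t → ∑ (necklaceTerm t) (divisors c)) d≡k*rad ⟩
    ∑ (necklaceTerm (k ℕ.* c)) (divisors c)                 ≈⟨ ∑-expand k c (divisors c) (∈-divisors⁻ {n = c}) ⟩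
    expand k (∑ (necklaceTerm c) (divisors c))              ∎
    where open ≋-Reasoning

  -- M_c(xᵏ) = (d/c)·M_d(x): scaling by the inverse of `invN d` clears the factor 1/d, and `invN c`
  -- puts 1/c in its place.
  ∣necklace⇒∣expand-rad : ∀ {P} → P ∣ necklace d → P ∣ expand k (necklace c)
  ∣necklace⇒∣expand-rad P∣ = ∣-resp refl (begin
    scaleₚ (invN c) (scaleₚ (ℚ.1/ invN d) (necklace d))  ≈⟨ scale-cong (invN c) (scale-scale (ℚ.1/ invN d) (invN d) S) ⟩
    scaleₚ (invN c) (scaleₚ (ℚ.1/ invN d ℚ.* invN d) S)  ≡⟨ cong (λ b → scaleₚ (invN c) (scaleₚ b S)) (ℚ.*-inverseˡ (invN d)) ⟩
    scaleₚ (invN c) (scaleₚ 1ℚ S)                        ≈⟨ scale-cong (invN c) (trans (scale-1 S) necklaceSum-rad) ⟩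
    scaleₚ (invN c) (expand k (∑ (necklaceTerm c) (divisors c)))  ≈⟨ expand-scale k (invN c) (∑ (necklaceTerm c) (divisors c)) ⟨
    expand k (necklace c)                                ∎)
    (∣-scale (invN c) (∣-scale (ℚ.1/ invN d) P∣))
    where
    open ≋-Reasoning
    instance
      invN-d-nonZero : ℚ.NonZero (invN d)
      invN-d-nonZero = invN-nonZero d

theorem2p9 : (d : ℕ) → 1 ≤ d → (m : ℕ) → (Φm : Poly) →
    IsCyclotomic m Φm → Φm ∣ₚ necklace d →
    Σ ℕ (λ n → Σ Poly (λ Φn →
    IsCyclotomic n Φn ×
    Φn ∣ₚ necklace (rad d) ×
    Φm ∣ₚ expand (divN d (rad d)) Φn))
theorem2p9 d 1≤d m Φm (1≤m , formula) (r , Φm∣M) with rad-∣ d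
... | ℕ.divides k d≡k*rad =
  n , Φₙ , (ℕ.>-nonZero⁻¹ n {{n-nonZero}} , at (Cyclotomic.productFormula isCyclotomic)) ,
  toₚ (descend (necklace (rad d)) (∣necklace⇒∣expand-rad d k d≡k*rad (divides r (coeffwise Φm∣M)))) ,
  toₚ (∣-resp refl (reflexive (cong (λ j → expand j Φₙ) (≡.sym quotient≡k))) lift)
  where
  instance
    d-nonZero : NonZero d
    d-nonZero = ℕ.>-nonZero 1≤d
    m-nonZero : NonZero m
    m-nonZero = ℕ.>-nonZero 1≤m
    k-nonZero : NonZero k
    k-nonZero = ℕ.m*n≢0⇒m≢0 k {n = rad d} {{≡.subst NonZero d≡k*rad d-nonZero}}
  open Descent (descent k {m} {Φm} (cyclotomic (coeffwise formula)))
  quotient≡k : divN d (rad d) ≡ k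
  quotient≡k = ≡.trans (cong (λ t → divN t (rad d)) d≡k*rad) (divN-* k (rad d) {{rad-nonZero d}})
  toₚ : ∀ {p q} → p ∣ q → p ∣ₚ q
  toₚ (divides s e) = s , at e
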